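{- Let $S$ and $S'$ be composition series of finite groups. Then $S \cong S'$ if and only if $X(S) \cong X(S')$ (as colored graphs).
   Context: All groups are finite. A composition series $S$ of a group $G$ is a maximal subnormal series $G_0 = 1 \triangleleft \cdots \triangleleft G_m = G$. Composition series $S$ of $G$ and $S'$ of $H$ (subgroups $H_0 = 1 \triangleleft \cdots \triangleleft H_{m'} = H$) are isomorphic, $S \cong S'$, if there is a group isomorphism $\phi : G \to H$ with $\phi[G_i] = H_i$ for each $i$ (in particular $m=m'$). $G/G_i$ denotes the set of left cosets of $G_i$ in $G$. The tree $T(S)$: the rooted tree with node set $\bigcup_i G/G_i$, root $G$, and an edge from each node $xG_{i+1} \in G/G_{i+1}$ to each $yG_i \in G/G_i$ with $yG_i \subseteq xG_{i+1}$. Its leaves are the nodes $\{x\} \in G/1$, identified with $x \in G$. Leaf product: $L(T)$ is the set of leaves (childless nodes) of a rooted tree $T$. For trees $T_1,T_2$ with roots $r_1,r_2$, $T_1 \odot T_2$ is the tree rooted at $r_1$ obtained by attaching to each leaf $x$ of $T_1$ a copy of $T_2$, with the root of the copy identified with $x$: its vertex set is $V(T_1) \cup \{(x,y) : x \in L(T_1),\ y \in V(T_2)\setminus\{r_2\}\}$, and its edges are $E(T_1)$, the pairs $(x,(x,y))$ with $x\in L(T_1)$, $(r_2,y) \in E(T_2)$, and the pairs $((x,y),(x,z))$ with $x\in L(T_1)$, $(y,z) \in E(T_2)$, $y,z \neq r_2$ (with the convention that $(x,r_2)$ means $x$). Leaf products are associative after identifying $(x,(y,z))$ and $((x,y),z)$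 with $(x,y,z)$. The graph $X(S)$: let $M$ be the tree consisting of a root connected to three nodes $\leftarrow$, $\rightarrow$, $=$ colored "left", "right", "equals" respectively. $X(S)$ is the colored (undirected) graph obtained from the tree $T(S) \odot T(S) \odot M$ by adding, for all $x,y \in G$, the path $((x,y,\leftarrow),(y,x,\rightarrow),(xy,y,=))$, i.e. the edges $\{(x,y,\leftarrow),(y,x,\rightarrow)\}$ and $\{(y,x,\rightarrow),(xy,y,=)\}$. Each leaf $(x,y,c)$ of $T(S)\odot T(S)\odot M$ has the color of $c$, and all other nodes are colored "internal". Colored graphs are isomorphic if there is a bijection of vertex sets respecting edges and colors. -}

module Defs where

open import Algebra.Bundles using (Group)
open import Algebra.Morphism.Structures using (module GroupMorphisms)
import Algebra.Properties.Group as GroupProperties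
open import Data.Empty using (⊥-elim)
open import Data.Fin.Base using (Fin; zero; suc; toℕ; fromℕ; inject₁)
open import Data.Fin.Induction using (<-weakInduction; >-weakInduction)
import Data.Fin.Properties as Fin
open import Data.Nat.Base using (ℕ; suc; _≤_; _<_; s≤s)
import Data.Nat.Properties as ℕ
open import Data.Product.Base using (Σ; ∃; _×_; _,_; proj₁; proj₂)
open import Data.Product.Relation.Binary.Pointwise.NonDependent using (_×ₛ_)
open import Data.Sum.Base using (inj₁; inj₂)
open import Data.Sum.Relation.Binary.Pointwise using (_⊎ₛ_; inj₁; inj₂)
open import Function.Base using (_∘_)
open import Function.Bundles using (Inverse; Bijection; _⇔_)
open import Level using (Level; _⊔_; 0ℓ) renaming (suc to lsuc)
open import Relation.Binary.Bundles using (Setoid)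
open import Relation.Binary.Construct.Closure.ReflexiveTransitive using (Star; ε; _◅_; _◅◅_)
open import Relation.Binary.Construct.Closure.Symmetric using (SymClosure; fwd; bwd; symmetric)
import Relation.Binary.Construct.On as On
open import Relation.Binary.Construct.Union using (_∪_)
open import Relation.Binary.Core using (Rel)
open import Relation.Binary.Definitions using (Symmetric; tri<; tri≈; tri>)
open import Relation.Binary.PropositionalEquality as ≡ using (_≡_; refl; subst)
import Relation.Binary.Reasoning.Setoid as SetoidReasoning
open import Relation.Nullary.Decidable using (Dec; yes; no; map′)
open import Relation.Nullary.Negation using (¬_; contradiction)
open import Relation.Unary using (Pred; Decidable; _∈_; _⊆_; _⊂_; _≐_)

private
  variable
    a a₁ a₂ b b₁ b₂ c c₁ c₂ e e₁ e₂ ℓ ℓ₁ ℓ₂ p p₁ p₂ : Level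

record FiniteGroup (c ℓ : Level) : Set (lsuc (c ⊔ ℓ)) where
  field
    group       : Group c ℓ
    order       : ℕ
    enumeration : Inverse (Group.setoid group) (≡.setoid (Fin order))

  open Group group public

  ∀-dec : {P : Pred Carrier p} → (∀ {x y} → x ≈ y → P x → P y) →
          Decidable P → Dec (∀ x → P x)
  ∀-dec resp P? = map′
    (λ h x → resp (strictlyInverseʳ x) (h (to x)))
    (λ h k → h (from k))
    (Fin.all? (P? ∘ from))
    where open Inverse enumeration

-- Subsets of a finite set are decidable predicates; classically the
-- field `member?` carries no information.
record Subgroup (G : FiniteGroup c ℓ) (p : Level) : Set (c ⊔ ℓ ⊔ lsuc p) where
  open FiniteGroup G using (Carrier; _≈_; _∙_; _⁻¹) renaming (ε to 1#)
  field
    member    : Pred Carrier p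
    member?   : Decidable member
    resp      : ∀ {x y} → x ≈ y → x ∈ member → y ∈ member
    1-closed  : 1# ∈ member
    ∙-closed  : ∀ {x y} → x ∈ member → y ∈ member → x ∙ y ∈ member
    ⁻¹-closed : ∀ {x} → x ∈ member → x ⁻¹ ∈ member

open Subgroup using (member)

module _ {G : FiniteGroup c ℓ} where
  open FiniteGroup G using (Carrier; _≈_; _∙_; _⁻¹)

  _◁_ : Subgroup G p → Subgroup G p → Set (c ⊔ p)
  N ◁ K = (member N ⊂ member K)
        × (∀ g n → g ∈ member K → n ∈ member N → (g ∙ n) ∙ (g ⁻¹) ∈ member N)

  _·_ : Carrier → Subgroup G p → Pred Carrier (c ⊔ ℓ ⊔ p)
  (x · K) z = ∃ λ g → g ∈ member K × x ∙ g ≈ z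

-- `_◁_` includes properness, so terms are not repeated.
record SubnormalSeries (G : FiniteGroup c ℓ) (p : Level) (m : ℕ)
       : Set (c ⊔ ℓ ⊔ lsuc p) where
  open FiniteGroup G using (_≈_) renaming (ε to 1#)
  field
    term   : Fin (suc m) → Subgroup G p
    bottom : member (term zero) ≐ (_≈ 1#)
    top    : ∀ x → x ∈ member (term (fromℕ m))
    normal : ∀ i → term (inject₁ i) ◁ term (suc i)

_⊑_ : {G : FiniteGroup c ℓ} {m n : ℕ} →
      SubnormalSeries G p m → SubnormalSeries G p n → Set (c ⊔ p)
S ⊑ R = ∀ i → ∃ λ j → member (term S i) ≐ member (term R j)
  where open SubnormalSeries

record CompositionSeries (G : FiniteGroup c ℓ) (p : Level) : Set (c ⊔ ℓ ⊔ lsuc p) where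
  field
    len     : ℕ
    series  : SubnormalSeries G p len
    maximal : ∀ {n} (R : SubnormalSeries G p n) → series ⊑ R → R ⊑ series

  open SubnormalSeries series public

record _≅ˢ_ {G : FiniteGroup c₁ ℓ₁} {H : FiniteGroup c₂ ℓ₂}
            (S : CompositionSeries G p₁) (S′ : CompositionSeries H p₂)
            : Set (c₁ ⊔ ℓ₁ ⊔ p₁ ⊔ c₂ ⊔ ℓ₂ ⊔ p₂) where
  private
    module G = FiniteGroup G
    module H = FiniteGroup H
    module S = CompositionSeries S
    module S′ = CompositionSeries S′
  open GroupMorphisms G.rawGroup H.rawGroup using (IsGroupIsomorphism)
  field
    φ      : G.Carrier → H.Carrier
    φ-iso  : IsGroupIsomorphism φ
    length : S.len ≡ S′.len
    image  : ∀ i j → toℕ i ≡ toℕ j →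
             (λ h → ∃ λ g → g ∈ member (S.term i) × φ g H.≈ h) ≐ member (S′.term j)

-- Edges are directed from parent to child; `root?` holds in any finite tree
-- and serves the convention (x , root) = x in leaf products.
record RootedTree (a b e : Level) : Set (lsuc (a ⊔ b ⊔ e)) where
  field
    V : Setoid a b
  open Setoid V public using (_≈_) renaming (Carrier to Vertex)
  field
    root          : Vertex
    E             : Rel Vertex e
    E-resp        : ∀ {u u′ v v′} → u ≈ u′ → v ≈ v′ → E u v → E u′ v′
    root?         : ∀ v → Dec (v ≈ root)
    root-orphan   : ∀ {u} → ¬ E u root
    unique-parent : ∀ {u u′ v} → E u v → E u′ v → u ≈ u′
    reachable     : ∀ v → ∃ λ u → Star E root u × u ≈ v

  IsLeaf : Pred Vertex (a ⊔ e)
  IsLeaf v = ∀ w → ¬ E v w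

  Leaf : Set (a ⊔ e)
  Leaf = Σ Vertex IsLeaf

  NonRoot : Set (a ⊔ b)
  NonRoot = Σ Vertex λ v → ¬ v ≈ root

  leafSetoid : Setoid (a ⊔ e) b
  leafSetoid = On.setoid {B = Leaf} V proj₁

  nonRootSetoid : Setoid (a ⊔ b) b
  nonRootSetoid = On.setoid {B = NonRoot} V proj₁

module LeafProduct (T₁ : RootedTree a₁ b₁ e₁) (T₂ : RootedTree a₂ b₂ e₂) where
  private
    module T₁ = RootedTree T₁
    module T₂ = RootedTree T₂
    module V₁ = Setoid T₁.V
    module V₂ = Setoid T₂.V

  ⊙V : Setoid (a₁ ⊔ e₁ ⊔ a₂ ⊔ b₂) (a₁ ⊔ e₁ ⊔ a₂ ⊔ b₁ ⊔ b₂)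
  ⊙V = T₁.V ⊎ₛ (T₁.leafSetoid ×ₛ T₂.nonRootSetoid)

  data ⊙E : Rel (Setoid.Carrier ⊙V) (a₁ ⊔ b₁ ⊔ e₁ ⊔ a₂ ⊔ b₂ ⊔ e₂) where
    inner : ∀ {u v} → T₁.E u v → ⊙E (inj₁ u) (inj₁ v)
    hang  : ∀ {u} {x : T₁.Leaf} {y : T₂.NonRoot} →
            u T₁.≈ proj₁ x → T₂.E T₂.root (proj₁ y) → ⊙E (inj₁ u) (inj₂ (x , y))
    copy  : ∀ {x x′ : T₁.Leaf} {y z : T₂.NonRoot} →
            proj₁ x T₁.≈ proj₁ x′ → T₂.E (proj₁ y) (proj₁ z) →
            ⊙E (inj₂ (x , y)) (inj₂ (x′ , z))

  open Setoid ⊙V using () renaming (_≈_ to _≈⊙_; Carrier to Vertex⊙)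

  ⊙E-resp : ∀ {u u′ v v′} → u ≈⊙ u′ → v ≈⊙ v′ → ⊙E u v → ⊙E u′ v′
  ⊙E-resp (inj₁ p) (inj₁ q) (inner d) = inner (T₁.E-resp p q d)
  ⊙E-resp (inj₁ p) (inj₂ (q , r)) (hang s d) =
    hang (V₁.trans (V₁.sym p) (V₁.trans s q)) (T₂.E-resp V₂.refl r d)
  ⊙E-resp (inj₂ (p , q)) (inj₂ (p′ , q′)) (copy s d) =
    copy (V₁.trans (V₁.sym p) (V₁.trans s p′)) (T₂.E-resp q q′ d)

  ⊙root? : ∀ v → Dec (v ≈⊙ inj₁ T₁.root)
  ⊙root? (inj₁ u) = map′ inj₁ (λ { (inj₁ p) → p }) (T₁.root? u)
  ⊙root? (inj₂ _) = no λ ()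

  ⊙root-orphan : ∀ {u} → ¬ ⊙E u (inj₁ T₁.root)
  ⊙root-orphan (inner d) = T₁.root-orphan d

  ⊙unique-parent : ∀ {u u′ v} → ⊙E u v → ⊙E u′ v → u ≈⊙ u′
  ⊙unique-parent (inner d) (inner d′) = inj₁ (T₁.unique-parent d d′)
  ⊙unique-parent (hang p _) (hang q _) = inj₁ (V₁.trans p (V₁.sym q))
  ⊙unique-parent (hang _ d) (copy {y = y} _ d′) =
    contradiction (T₂.unique-parent d′ d) (proj₂ y)
  ⊙unique-parent (copy {y = y} _ d) (hang _ d′) =
    contradiction (T₂.unique-parent d d′) (proj₂ y)
  ⊙unique-parent (copy p d) (copy q d′) =
    inj₂ (V₁.trans p (V₁.sym q) , T₂.unique-parent d d′)

  child-nonRoot : ∀ {u v} → T₂.E u v → ¬ v T₂.≈ T₂.root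
  child-nonRoot d p = T₂.root-orphan (T₂.E-resp V₂.refl p d)

  lift₁ : ∀ {u v} → Star T₁.E u v → Star ⊙E (inj₁ u) (inj₁ v)
  lift₁ ε        = ε
  lift₁ (d ◅ ds) = inner d ◅ lift₁ ds

  lift₂ : ∀ (x : T₁.Leaf) {u v} (u≉ : ¬ u T₂.≈ T₂.root) → Star T₂.E u v →
          ∃ λ v≉ → Star ⊙E (inj₂ (x , u , u≉)) (inj₂ (x , v , v≉))
  lift₂ x u≉ ε        = u≉ , ε
  lift₂ x u≉ (d ◅ ds) with lift₂ x (child-nonRoot d) ds
  ... | v≉ , ds′ = v≉ , copy V₁.refl d ◅ ds′

  ⊙reachable : ∀ v → ∃ λ u → Star ⊙E (inj₁ T₁.root) u × u ≈⊙ v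
  ⊙reachable (inj₁ v) with T₁.reachable v
  ... | u , ds , p = inj₁ u , lift₁ ds , inj₁ p
  ⊙reachable (inj₂ ((x , x-leaf) , (y , y≉))) with T₁.reachable x | T₂.reachable y
  ... | _ | _ , ε , q = contradiction (V₂.sym q) y≉
  ... | x′ , ds , p | y′ , d ◅ ds′ , q
    with lift₂ (x , x-leaf) (child-nonRoot d) ds′
  ...   | y′≉ , ds″ =
    inj₂ ((x , x-leaf) , y′ , y′≉) , lift₁ ds ◅◅ (hang p d ◅ ds″) , inj₂ (V₁.refl , q)

  -- (x , y), with the convention that (x , root) means x.
  pair : T₁.Leaf → T₂.Vertex → Vertex⊙
  pair x y with T₂.root? y
  ... | yes _ = inj₁ (proj₁ x)
  ... | no y≉ = inj₂ (x , y , y≉)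

infixl 6 _⊙_

_⊙_ : RootedTree a₁ b₁ e₁ → RootedTree a₂ b₂ e₂ →
      RootedTree (a₁ ⊔ e₁ ⊔ a₂ ⊔ b₂) (a₁ ⊔ e₁ ⊔ a₂ ⊔ b₁ ⊔ b₂)
                 (a₁ ⊔ b₁ ⊔ e₁ ⊔ a₂ ⊔ b₂ ⊔ e₂)
T₁ ⊙ T₂ = record
  { V             = ⊙V
  ; root          = inj₁ (RootedTree.root T₁)
  ; E             = ⊙E
  ; E-resp        = ⊙E-resp
  ; root?         = ⊙root?
  ; root-orphan   = ⊙root-orphan
  ; unique-parent = ⊙unique-parent
  ; reachable     = ⊙reachable
  }
  where open LeafProduct T₁ T₂

module _ {T₁ : RootedTree a₁ b₁ e₁} {T₂ : RootedTree a₂ b₂ e₂} where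
  private
    module T₁ = RootedTree T₁
    module T₂ = RootedTree T₂
  open LeafProduct T₁ T₂

  pair-isLeaf : (x : T₁.Leaf) (y : T₂.Leaf) →
                RootedTree.IsLeaf (T₁ ⊙ T₂) (pair x (proj₁ y))
  pair-isLeaf (x , x-leaf) (y , y-leaf) w d with T₂.root? y
  pair-isLeaf (x , x-leaf) (y , y-leaf) _ (inner d) | yes _ = x-leaf _ d
  pair-isLeaf (x , x-leaf) (y , y-leaf) _ (hang _ d) | yes y≈ =
    y-leaf _ (T₂.E-resp (Setoid.sym T₂.V y≈) (Setoid.refl T₂.V) d)
  pair-isLeaf (x , x-leaf) (y , y-leaf) _ (copy _ d) | no _ = y-leaf _ d

  leafPair : T₁.Leaf → T₂.Leaf → RootedTree.Leaf (T₁ ⊙ T₂)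
  leafPair x y = pair x (proj₁ y) , pair-isLeaf x y

module CosetTree {G : FiniteGroup c ℓ} (S : CompositionSeries G p) where
  open FiniteGroup G using (Carrier; _≈_; _∙_; _⁻¹; setoid; sym; trans; assoc; ∙-congˡ;
    identityʳ; ∀-dec) renaming (ε to 1#; refl to ≈-refl)
  open GroupProperties (FiniteGroup.group G) using (\\-leftDividesˡ; \\-leftDividesʳ)
  open CompositionSeries S using (len; term; top; normal)
  open Subgroup using (member?; resp; 1-closed; ∙-closed; ⁻¹-closed)

  -- The pair (i , x) denotes the coset x G_i; two nodes are equal when
  -- they are equal as subsets of G.
  Node : Set c
  Node = Fin (suc len) × Carrier

  coset : Node → Pred Carrier (c ⊔ ℓ ⊔ p)
  coset (i , x) = x · term i

  nodeSetoid : Setoid c (c ⊔ ℓ ⊔ p)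
  nodeSetoid = record
    { Carrier       = Node
    ; _≈_           = λ u v → coset u ≐ coset v
    ; isEquivalence = record
      { refl  = (λ z → z) , (λ z → z)
      ; sym   = λ (f , g) → g , f
      ; trans = λ (f , g) (f′ , g′) → (λ z → f′ (f z)) , (λ z → g (g′ z))
      }
    }

  open Setoid nodeSetoid using () renaming (_≈_ to _≈ₙ_; sym to symₙ; trans to transₙ)

  rootNode : Node
  rootNode = fromℕ len , 1#

  data Edge (u v : Node) : Set (c ⊔ ℓ ⊔ p) where
    edge : ∀ i x y → u ≈ₙ (suc i , x) → v ≈ₙ (inject₁ i , y) →
           coset (inject₁ i , y) ⊆ coset (suc i , x) → Edge u v

  self∈ : ∀ i x → x ∈ coset (i , x)
  self∈ i x = 1# , 1-closed (term i) , identityʳ x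

  quotient∈ : ∀ i {x z} → z ∈ coset (i , x) → x ⁻¹ ∙ z ∈ member (term i)
  quotient∈ i {x} {z} (g , g∈ , xg≈z) =
    resp (term i) (trans (sym (\\-leftDividesʳ x g)) (∙-congˡ xg≈z)) g∈

  ∈coset : ∀ i {x z} → x ⁻¹ ∙ z ∈ member (term i) → z ∈ coset (i , x)
  ∈coset i {x} {z} h = x ⁻¹ ∙ z , h , \\-leftDividesˡ x z

  shift : ∀ x y z → (x ⁻¹ ∙ y) ⁻¹ ∙ (x ⁻¹ ∙ z) ≈ y ⁻¹ ∙ z
  shift x y z = begin
    (x ⁻¹ ∙ y) ⁻¹ ∙ (x ⁻¹ ∙ z)              ≈⟨ ∙-congˡ (∙-congˡ (\\-leftDividesˡ y z)) ⟨
    (x ⁻¹ ∙ y) ⁻¹ ∙ (x ⁻¹ ∙ (y ∙ (y ⁻¹ ∙ z))) ≈⟨ ∙-congˡ (assoc (x ⁻¹) y (y ⁻¹ ∙ z)) ⟨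
    (x ⁻¹ ∙ y) ⁻¹ ∙ ((x ⁻¹ ∙ y) ∙ (y ⁻¹ ∙ z)) ≈⟨ \\-leftDividesʳ (x ⁻¹ ∙ y) (y ⁻¹ ∙ z) ⟩
    y ⁻¹ ∙ z                                  ∎
    where open SetoidReasoning setoid

  difference∈ : ∀ i {x y z} → y ∈ coset (i , x) → z ∈ coset (i , x) →
                y ⁻¹ ∙ z ∈ member (term i)
  difference∈ i {x} {y} {z} y∈ z∈ = resp (term i) (shift x y z)
    (∙-closed (term i) (⁻¹-closed (term i) (quotient∈ i y∈)) (quotient∈ i z∈))

  sameCoset : ∀ i {x y} → y ∈ coset (i , x) → (i , x) ≈ₙ (i , y)
  sameCoset i {x} {y} y∈ =
      (λ z∈ → ∈coset i (difference∈ i y∈ z∈))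
    , (λ z∈ → ∈coset i (difference∈ i (∈coset i (difference∈ i y∈ (self∈ i x))) z∈))

  ⊆-term : ∀ {i j x y} → coset (i , x) ⊆ coset (j , y) → member (term i) ⊆ member (term j)
  ⊆-term {i} {j} {x} sub {g} g∈ =
    resp (term j) (\\-leftDividesʳ x g)
      (difference∈ j (sub (self∈ i x)) (sub (g , g∈ , ≈-refl)))

  term-mono : ∀ j i → toℕ i ≤ toℕ j → member (term i) ⊆ member (term j)
  term-mono = <-weakInduction _ base step
    where
    base : ∀ i → toℕ i ≤ 0 → member (term i) ⊆ member (term zero)
    base zero _ z = z
    step : ∀ j → (∀ i → toℕ i ≤ toℕ (inject₁ j) → member (term i) ⊆ member (term (inject₁ j))) →
           ∀ i → toℕ i ≤ suc (toℕ j) → member (term i) ⊆ member (term (suc j))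
    step j ih i i≤ z with ℕ.m≤n⇒m<n∨m≡n i≤
    ... | inj₁ (s≤s i≤j) =
      proj₁ (proj₁ (normal j)) (ih i (subst (toℕ i ≤_) (≡.sym (Fin.toℕ-inject₁ j)) i≤j) z)
    ... | inj₂ i≡ = subst (λ k → _ ∈ member (term k)) (Fin.toℕ-injective i≡) z

  term-strict : ∀ i j → toℕ i < toℕ j → ¬ member (term j) ⊆ member (term i)
  term-strict i (suc j) (s≤s i≤j) sub = proj₂ (proj₁ (normal j)) λ z∈ →
    term-mono (inject₁ j) i (subst (toℕ i ≤_) (≡.sym (Fin.toℕ-inject₁ j)) i≤j) (sub z∈)

  level-unique : ∀ {i j x y} → (i , x) ≈ₙ (j , y) → i ≡ j
  level-unique {i} {j} (f , g) with ℕ.<-cmp (toℕ i) (toℕ j)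
  ... | tri< i<j _ _ = ⊥-elim (term-strict i j i<j (⊆-term g))
  ... | tri≈ _ i≡j _ = Fin.toℕ-injective i≡j
  ... | tri> _ _ j<i = ⊥-elim (term-strict j i j<i (⊆-term f))

  rootNode? : ∀ v → Dec (v ≈ₙ rootNode)
  rootNode? (i , x) = map′
    (λ all → (λ _ → ∈coset (fromℕ len) (top _)) , (λ _ → ∈coset i (all _)))
    (λ (_ , g) z → ⊆-term g (top z))
    (∀-dec (resp (term i)) (member? (term i)))

  Edge-resp : ∀ {u u′ v v′} → u ≈ₙ u′ → v ≈ₙ v′ → Edge u v → Edge u′ v′
  Edge-resp {u} {u′} {v} {v′} p q (edge i x y r s sub) =
    edge i x y (transₙ {u′} {u} {suc i , x} (symₙ {u} {u′} p) r)
               (transₙ {v′} {v} {inject₁ i , y} (symₙ {v} {v′} q) s) sub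

  rootNode-orphan : ∀ {u} → ¬ Edge u rootNode
  rootNode-orphan (edge i x y _ s _) = Fin.fromℕ≢inject₁ (level-unique s)

  Edge-unique : ∀ {u u′ v} → Edge u v → Edge u′ v → u ≈ₙ u′
  Edge-unique {u} {u′} {v} (edge i x y r s sub) (edge j x′ y′ r′ s′ sub′)
    with Fin.inject₁-injective
           (level-unique (transₙ {inject₁ i , y} {v} {inject₁ j , y′}
                           (symₙ {v} {inject₁ i , y} s) s′))
  ... | refl = transₙ {u} {suc i , x} {u′} r
      (transₙ {suc i , x} {suc i , y} {u′} (sameCoset (suc i) (sub (self∈ (inject₁ i) y)))
        (transₙ {suc i , y} {suc i , x′} {u′}
          (symₙ {suc i , x′} {suc i , y}
            (sameCoset (suc i) (sub′ (proj₁ s′ (proj₂ s (self∈ (inject₁ i) y))))))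
          (symₙ {u′} {suc i , x′} r′)))

  Node-reachable : ∀ v → ∃ λ u → Star Edge rootNode u × u ≈ₙ v
  Node-reachable (i , x) = >-weakInduction Reach base step i x
    where
    Reach : Fin (suc len) → Set _
    Reach i = ∀ x → ∃ λ u → Star Edge rootNode u × u ≈ₙ (i , x)
    base : Reach (fromℕ len)
    base x = rootNode , ε , sameCoset (fromℕ len) (∈coset (fromℕ len) (top _))
    step : ∀ i → Reach (suc i) → Reach (inject₁ i)
    step i ih x with ih x
    ... | u , path , p = (inject₁ i , x)
        , path ◅◅ (edge i x x p ((λ z → z) , (λ z → z)) sub ◅ ε)
        , (λ z → z) , (λ z → z)
      where
      sub : coset (inject₁ i , x) ⊆ coset (suc i , x)
      sub (g , g∈ , q) = g , proj₁ (proj₁ (normal i)) g∈ , q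

  T : RootedTree c (c ⊔ ℓ ⊔ p) (c ⊔ ℓ ⊔ p)
  T = record
    { V             = nodeSetoid
    ; root          = rootNode
    ; E             = Edge
    ; E-resp        = λ {u} {u′} {v} {v′} → Edge-resp {u} {u′} {v} {v′}
    ; root?         = rootNode?
    ; root-orphan   = rootNode-orphan
    ; unique-parent = Edge-unique
    ; reachable     = Node-reachable
    }

  leaf : Carrier → RootedTree.Leaf T
  leaf x = (zero , x) , λ { w (edge i x′ y r _ _) → contradiction (level-unique r) λ () }

data Color : Set where
  internal left right equals : Color

data MNode : Set where
  mroot ←ₘ →ₘ =ₘ : MNode

data MEdge : Rel MNode 0ℓ where
  to-← : MEdge mroot ←ₘ
  to-→ : MEdge mroot →ₘ
  to-= : MEdge mroot =ₘ

M : RootedTree 0ℓ 0ℓ 0ℓ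
M = record
  { V             = ≡.setoid MNode
  ; root          = mroot
  ; E             = MEdge
  ; E-resp        = λ { refl refl d → d }
  ; root?         = λ { mroot → yes refl ; ←ₘ → no λ () ; →ₘ → no λ () ; =ₘ → no λ () }
  ; root-orphan   = λ ()
  ; unique-parent = λ { to-← to-← → refl ; to-→ to-→ → refl ; to-= to-= → refl }
  ; reachable     = λ
    { mroot → mroot , ε , refl
    ; ←ₘ → ←ₘ , to-← ◅ ε , refl
    ; →ₘ → →ₘ , to-→ ◅ ε , refl
    ; =ₘ → =ₘ , to-= ◅ ε , refl
    }
  }

mcolor : MNode → Color
mcolor mroot = internal
mcolor ←ₘ    = left
mcolor →ₘ    = right
mcolor =ₘ    = equals

←-leaf →-leaf =-leaf : RootedTree.Leaf M
←-leaf = ←ₘ , λ _ ()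
→-leaf = →ₘ , λ _ ()
=-leaf = =ₘ , λ _ ()

record ColoredGraph (a b e : Level) : Set (lsuc (a ⊔ b ⊔ e)) where
  field
    V : Setoid a b
  open Setoid V public using (_≈_) renaming (Carrier to Vertex)
  field
    Adj        : Rel Vertex e
    Adj-sym    : Symmetric Adj
    Adj-resp   : ∀ {u u′ v v′} → u ≈ u′ → v ≈ v′ → Adj u v → Adj u′ v′
    color      : Vertex → Color
    color-cong : ∀ {u v} → u ≈ v → color u ≡ color v

record _≅ᵍ_ (X : ColoredGraph a₁ b₁ e₁) (Y : ColoredGraph a₂ b₂ e₂)
            : Set (a₁ ⊔ b₁ ⊔ e₁ ⊔ a₂ ⊔ b₂ ⊔ e₂) where
  private
    module X = ColoredGraph X
    module Y = ColoredGraph Y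
  field
    bijection : Bijection X.V Y.V
  open Bijection bijection using (to)
  field
    edges  : ∀ u v → X.Adj u v ⇔ Y.Adj (to u) (to v)
    colors : ∀ u → Y.color (to u) ≡ X.color u

module GraphOfSeries {G : FiniteGroup c ℓ} (S : CompositionSeries G p) where
  open FiniteGroup G using (Carrier; _∙_)
  open CosetTree S using (T; leaf)

  tree : RootedTree (c ⊔ ℓ ⊔ p) (c ⊔ ℓ ⊔ p) (c ⊔ ℓ ⊔ p)
  tree = T ⊙ T ⊙ M

  open RootedTree tree using (V; Vertex; _≈_; E; E-resp)

  ⟨_,_,_⟩ : Carrier → Carrier → RootedTree.Leaf M → Vertex
  ⟨ x , y , m ⟩ = proj₁ (leafPair {T₁ = T ⊙ T} {T₂ = M}
                          (leafPair {T₁ = T} {T₂ = T} (leaf x) (leaf y)) m)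

  data PathEdge (u v : Vertex) : Set (c ⊔ ℓ ⊔ p) where
    ←→ : ∀ x y → u ≈ ⟨ x , y , ←-leaf ⟩ → v ≈ ⟨ y , x , →-leaf ⟩ → PathEdge u v
    →= : ∀ x y → u ≈ ⟨ y , x , →-leaf ⟩ → v ≈ ⟨ x ∙ y , y , =-leaf ⟩ → PathEdge u v

  PathEdge-resp : ∀ {u u′ v v′} → u ≈ u′ → v ≈ v′ → PathEdge u v → PathEdge u′ v′
  PathEdge-resp p q (←→ x y r s) = ←→ x y (trans (sym p) r) (trans (sym q) s)
    where open Setoid V using (sym; trans)
  PathEdge-resp p q (→= x y r s) = →= x y (trans (sym p) r) (trans (sym q) s)
    where open Setoid V using (sym; trans)

  Adjacent : Rel Vertex (c ⊔ ℓ ⊔ p)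
  Adjacent = SymClosure (E ∪ PathEdge)

  Adjacent-resp : ∀ {u u′ v v′} → u ≈ u′ → v ≈ v′ → Adjacent u v → Adjacent u′ v′
  Adjacent-resp p q (fwd (inj₁ d)) = fwd (inj₁ (E-resp p q d))
  Adjacent-resp p q (fwd (inj₂ d)) = fwd (inj₂ (PathEdge-resp p q d))
  Adjacent-resp p q (bwd (inj₁ d)) = bwd (inj₁ (E-resp q p d))
  Adjacent-resp p q (bwd (inj₂ d)) = bwd (inj₂ (PathEdge-resp q p d))

  -- The vertices `inj₂ _` of (T ⊙ T) ⊙ M are exactly its leaves.
  vertexColor : Vertex → Color
  vertexColor (inj₁ _)             = internal
  vertexColor (inj₂ (_ , (m , _))) = mcolor m

  vertexColor-cong : ∀ {u v} → u ≈ v → vertexColor u ≡ vertexColor v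
  vertexColor-cong (inj₁ _)       = refl
  vertexColor-cong (inj₂ (_ , q)) = ≡.cong mcolor q

X : {G : FiniteGroup c ℓ} → CompositionSeries G p →
    ColoredGraph (c ⊔ ℓ ⊔ p) (c ⊔ ℓ ⊔ p) (c ⊔ ℓ ⊔ p)
X S = record
  { V          = RootedTree.V tree
  ; Adj        = Adjacent
  ; Adj-sym    = symmetric _
  ; Adj-resp   = Adjacent-resp
  ; color      = vertexColor
  ; color-cong = vertexColor-cong
  }
  where open GraphOfSeries S

{-# OPTIONS --safe #-}
module Submission where

-- An isomorphism of series acts on cosets, hence on T(S), on the leaf products and on X(S).
-- Conversely, an isomorphism X(S) → X(S′) preserves the height of internal vertices above the
-- leaves of T ⊙ T, because height 0 means being adjacent to a colored vertex.  It therefore maps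
-- T(S) to T(S′), the leaf x going to some α x, and maps (x , y) to (α x , β x y).  The edges
-- (x,y,←)–(y,x,→) force β x y = α y, and then the edges (y,x,→)–(xy,y,=) make α a homomorphism.
-- Since parents are unique, x G_i is mapped to (α x) H_i, so α carries G_i to H_i.

open import Defs
open import Algebra.Morphism.Structures using (module GroupMorphisms)
import Algebra.Properties.Group as GroupProperties
open import Data.Nat.Base using (ℕ; zero; suc; _+_; _≤_; _<_; s≤s)
import Data.Nat.Properties as ℕ
open import Data.Fin.Base using (Fin; zero; suc; toℕ; fromℕ; inject₁; cast)
open import Data.Fin.Induction using (<-weakInduction)
import Data.Fin.Properties as Fin
open import Data.Product.Base using (∃; _×_; _,_; proj₁; proj₂)
open import Data.Sum.Base using (_⊎_; inj₁; inj₂)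
open import Data.Sum.Relation.Binary.Pointwise using (inj₁; inj₂; drop-inj₁)
open import Function.Base using (_∘_)
open import Function.Bundles using (_⇔_; mk⇔; Equivalence; Bijection)
open import Level using (Level; _⊔_) renaming (suc to lsuc)
open import Relation.Binary.Bundles using (Setoid)
open import Relation.Binary.Construct.Closure.ReflexiveTransitive using (Star; ε; _◅_)
open import Relation.Binary.Construct.Closure.Symmetric using (SymClosure; fwd; bwd)
open import Relation.Binary.Core using (Rel)
open import Relation.Binary.PropositionalEquality as ≡ using (_≡_; refl; cong; subst)
open import Relation.Nullary.Decidable using (yes; no)
open import Relation.Nullary.Negation using (¬_; contradiction)
open import Relation.Unary using (_∈_)

private
  variable
    a a₁ a₂ a₃ a₄ b b₁ b₂ b₃ b₄ c c₁ c₂ e e₁ e₂ e₃ e₄ ℓ ℓ₁ ℓ₂ p p₁ p₂ : Level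

-- Pairs in a leaf product.

module PairProperties (T₁ : RootedTree a₁ b₁ e₁) (T₂ : RootedTree a₂ b₂ e₂) where
  private
    module T₁ = RootedTree T₁
    module T₂ = RootedTree T₂
    module V₁ = Setoid T₁.V
    module V₂ = Setoid T₂.V
  open LeafProduct T₁ T₂
  open Setoid ⊙V using () renaming (_≈_ to _≈⊙_)

  pair-root : ∀ x {y} → y T₂.≈ T₂.root → pair x y ≈⊙ inj₁ (proj₁ x)
  pair-root x {y} y≈ with T₂.root? y
  ... | yes _ = inj₁ V₁.refl
  ... | no y≉ = contradiction y≈ y≉

  pair-nonRoot : ∀ x {y} (y≉ : ¬ y T₂.≈ T₂.root) → pair x y ≈⊙ inj₂ (x , y , y≉)
  pair-nonRoot x {y} y≉ with T₂.root? y
  ... | yes y≈ = contradiction y≈ y≉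
  ... | no _   = inj₂ (V₁.refl , V₂.refl)

  pair-cong : ∀ {x x′ y y′} → proj₁ x T₁.≈ proj₁ x′ → y T₂.≈ y′ → pair x y ≈⊙ pair x′ y′
  pair-cong {y = y} {y′} p q with T₂.root? y | T₂.root? y′
  ... | yes _  | yes _  = inj₁ p
  ... | yes y≈ | no y′≉ = contradiction (V₂.trans (V₂.sym q) y≈) y′≉
  ... | no y≉  | yes y′≈ = contradiction (V₂.trans q y′≈) y≉
  ... | no _   | no _   = inj₂ (p , q)

  -- A pair whose second entry is the root lies in `T₁` and any other pair lies in a hanging copy,
  -- so the two kinds are never equal.
  pair-injective : ∀ {x x′ y y′} → pair x y ≈⊙ pair x′ y′ →
                   proj₁ x T₁.≈ proj₁ x′ × y T₂.≈ y′
  pair-injective {y = y} {y′} r with T₂.root? y | T₂.root? y′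
  pair-injective (inj₁ p)       | yes y≈ | yes y′≈ = p , V₂.trans y≈ (V₂.sym y′≈)
  pair-injective (inj₂ (p , q)) | no _   | no _    = p , q

  pair-E : ∀ x {y z} → T₂.E y z → ⊙E (pair x y) (pair x z)
  pair-E x {y} {z} d with T₂.root? y | T₂.root? z
  ... | _      | yes z≈ = contradiction z≈ (child-nonRoot d)
  ... | yes y≈ | no _   = hang V₁.refl (T₂.E-resp y≈ V₂.refl d)
  ... | no _   | no _   = copy V₁.refl d

  -- No edge of `T₁` leaves the leaf `x`, so every child of `(x , y)` stays in the copy of `T₂`
  -- hanging at `x`. This later confines the image of a whole copy of T(S) to a single copy of
  -- T(S′).
  pair-E⁻ : ∀ x {y w} → ⊙E (pair x y) w → ∃ λ z → T₂.E y z × w ≈⊙ pair x z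
  pair-E⁻ x {y} d with T₂.root? y
  pair-E⁻ x (inner d) | yes _ = contradiction d (proj₂ x _)
  pair-E⁻ x (hang {x = x′} {y = z , z≉} p d) | yes y≈ =
    z , T₂.E-resp (V₂.sym y≈) V₂.refl d ,
    Setoid.sym ⊙V (Setoid.trans ⊙V (pair-nonRoot x z≉) (inj₂ (p , V₂.refl)))
  pair-E⁻ x (copy {z = z , z≉} p d) | no _ =
    z , d , Setoid.sym ⊙V (Setoid.trans ⊙V (pair-nonRoot x z≉) (inj₂ (p , V₂.refl)))

-- Isomorphisms of rooted trees and of their leaf products.

record TreeHom (T₁ : RootedTree a₁ b₁ e₁) (T₂ : RootedTree a₂ b₂ e₂)
       : Set (a₁ ⊔ b₁ ⊔ e₁ ⊔ a₂ ⊔ b₂ ⊔ e₂) where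
  private
    module T₁ = RootedTree T₁
    module T₂ = RootedTree T₂
  field
    ⟦_⟧       : T₁.Vertex → T₂.Vertex
    ⟦⟧-cong   : ∀ {u v} → u T₁.≈ v → ⟦ u ⟧ T₂.≈ ⟦ v ⟧
    root-pres : ⟦ T₁.root ⟧ T₂.≈ T₂.root
    E-pres    : ∀ {u v} → T₁.E u v → T₂.E ⟦ u ⟧ ⟦ v ⟧

record TreeIso (T₁ : RootedTree a₁ b₁ e₁) (T₂ : RootedTree a₂ b₂ e₂)
       : Set (a₁ ⊔ b₁ ⊔ e₁ ⊔ a₂ ⊔ b₂ ⊔ e₂) where
  private
    module T₁ = RootedTree T₁
    module T₂ = RootedTree T₂
    module V₁ = Setoid T₁.V
    module V₂ = Setoid T₂.V
  field
    to      : TreeHom T₁ T₂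
    from    : TreeHom T₂ T₁
  open TreeHom to public
  private module From = TreeHom from
  field
    to∘from : ∀ v → ⟦ From.⟦ v ⟧ ⟧ T₂.≈ v
    from∘to : ∀ v → From.⟦ ⟦ v ⟧ ⟧ T₁.≈ v

  -- A homomorphism alone may send a leaf to an inner node; here the inverse pulls a child of the
  -- image back to a child of `v`. This is why `⊙-hom` asks for an isomorphism of the first factor.
  leafMap : T₁.Leaf → T₂.Leaf
  leafMap (v , v-leaf) = ⟦ v ⟧ , λ w d →
    v-leaf _ (T₁.E-resp (from∘to v) V₁.refl (From.E-pres d))

  nonRootMap : T₁.NonRoot → T₂.NonRoot
  nonRootMap (v , v≉) = ⟦ v ⟧ , λ q →
    v≉ (V₁.trans (V₁.sym (from∘to v)) (V₁.trans (From.⟦⟧-cong q) From.root-pres))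

TreeIso-sym : {T₁ : RootedTree a₁ b₁ e₁} {T₂ : RootedTree a₂ b₂ e₂} →
              TreeIso T₁ T₂ → TreeIso T₂ T₁
TreeIso-sym τ = record { to = from ; from = to ; to∘from = from∘to ; from∘to = to∘from }
  where open TreeIso τ

TreeIso-refl : (T : RootedTree a b e) → TreeIso T T
TreeIso-refl T = record { to = id ; from = id ; to∘from = λ _ → refl′ ; from∘to = λ _ → refl′ }
  where
  open Setoid (RootedTree.V T) using () renaming (refl to refl′)
  id : TreeHom T T
  id = record { ⟦_⟧ = λ v → v ; ⟦⟧-cong = λ q → q ; root-pres = refl′ ; E-pres = λ d → d }

module _ {T₁ : RootedTree a₁ b₁ e₁} {T₂ : RootedTree a₂ b₂ e₂}
         {T₃ : RootedTree a₃ b₃ e₃} {T₄ : RootedTree a₄ b₄ e₄} where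
  private
    module T₁ = RootedTree T₁
    module T₂ = RootedTree T₂
    module V₄ = Setoid (RootedTree.V T₄)
    module P  = LeafProduct T₁ T₂
    module P′ = LeafProduct T₃ T₄
    module P′-pair = PairProperties T₃ T₄

  ⊙-hom : TreeIso T₁ T₃ → TreeIso T₂ T₄ → TreeHom (T₁ ⊙ T₂) (T₃ ⊙ T₄)
  ⊙-hom τ σ = record { ⟦_⟧ = f ; ⟦⟧-cong = f-cong ; root-pres = inj₁ τ.root-pres ; E-pres = f-E }
    where
    module τ = TreeIso τ
    module σ = TreeIso σ
    f : RootedTree.Vertex (T₁ ⊙ T₂) → RootedTree.Vertex (T₃ ⊙ T₄)
    f (inj₁ v)       = inj₁ τ.⟦ v ⟧
    f (inj₂ (x , y)) = inj₂ (τ.leafMap x , σ.nonRootMap y)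
    f-cong : ∀ {u v} → RootedTree._≈_ (T₁ ⊙ T₂) u v → RootedTree._≈_ (T₃ ⊙ T₄) (f u) (f v)
    f-cong (inj₁ q)       = inj₁ (τ.⟦⟧-cong q)
    f-cong (inj₂ (q , r)) = inj₂ (τ.⟦⟧-cong q , σ.⟦⟧-cong r)
    f-E : ∀ {u v} → P.⊙E u v → P′.⊙E (f u) (f v)
    f-E (P.inner d)  = P′.inner (τ.E-pres d)
    f-E (P.hang q d) =
      P′.hang (τ.⟦⟧-cong q) (RootedTree.E-resp T₄ σ.root-pres V₄.refl (σ.E-pres d))
    f-E (P.copy q d) = P′.copy (τ.⟦⟧-cong q) (σ.E-pres d)

  -- Roots go to roots and non-roots to non-roots, so the map respects the convention that (x ,
  -- root) means x.
  ⊙-hom-pair : (τ : TreeIso T₁ T₃) (σ : TreeIso T₂ T₄) (x : T₁.Leaf) (y : T₂.Vertex) →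
               RootedTree._≈_ (T₃ ⊙ T₄) (TreeHom.⟦_⟧ (⊙-hom τ σ) (P.pair x y))
                 (P′.pair (TreeIso.leafMap τ x) (TreeIso.⟦_⟧ σ y))
  ⊙-hom-pair τ σ x y with T₂.root? y
  ... | yes y≈ = Setoid.sym P′.⊙V (P′-pair.pair-root (τ.leafMap x)
                   (V₄.trans (σ.⟦⟧-cong y≈) σ.root-pres))
    where
    module τ = TreeIso τ
    module σ = TreeIso σ
  ... | no y≉  = Setoid.sym P′.⊙V (P′-pair.pair-nonRoot (TreeIso.leafMap τ x)
                   (proj₂ (TreeIso.nonRootMap σ (y , y≉))))

module _ {T₁ : RootedTree a₁ b₁ e₁} {T₂ : RootedTree a₂ b₂ e₂}
         {T₃ : RootedTree a₃ b₃ e₃} {T₄ : RootedTree a₄ b₄ e₄} where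

  ⊙-hom-inverse : (τ : TreeIso T₁ T₃) (σ : TreeIso T₂ T₄) → ∀ v →
    RootedTree._≈_ (T₁ ⊙ T₂)
      (TreeHom.⟦_⟧ (⊙-hom (TreeIso-sym τ) (TreeIso-sym σ)) (TreeHom.⟦_⟧ (⊙-hom τ σ) v)) v
  ⊙-hom-inverse τ σ (inj₁ v) = inj₁ (TreeIso.from∘to τ v)
  ⊙-hom-inverse τ σ (inj₂ ((x , _) , (y , _))) =
    inj₂ (TreeIso.from∘to τ x , TreeIso.from∘to σ y)

⊙-iso : {T₁ : RootedTree a₁ b₁ e₁} {T₂ : RootedTree a₂ b₂ e₂}
        {T₃ : RootedTree a₃ b₃ e₃} {T₄ : RootedTree a₄ b₄ e₄} →
        TreeIso T₁ T₃ → TreeIso T₂ T₄ → TreeIso (T₁ ⊙ T₂) (T₃ ⊙ T₄)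
⊙-iso τ σ = record
  { to      = ⊙-hom τ σ
  ; from    = ⊙-hom (TreeIso-sym τ) (TreeIso-sym σ)
  ; to∘from = ⊙-hom-inverse (TreeIso-sym τ) (TreeIso-sym σ)
  ; from∘to = ⊙-hom-inverse τ σ
  }

-- Isomorphisms of colored graphs as inverse pairs of homomorphisms.

record GraphHom (Y : ColoredGraph a₁ b₁ e₁) (Z : ColoredGraph a₂ b₂ e₂)
       : Set (a₁ ⊔ b₁ ⊔ e₁ ⊔ a₂ ⊔ b₂ ⊔ e₂) where
  private
    module Y = ColoredGraph Y
    module Z = ColoredGraph Z
  field
    ⟦_⟧        : Y.Vertex → Z.Vertex
    ⟦⟧-cong    : ∀ {u v} → u Y.≈ v → ⟦ u ⟧ Z.≈ ⟦ v ⟧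
    Adj-pres   : ∀ {u v} → Y.Adj u v → Z.Adj ⟦ u ⟧ ⟦ v ⟧
    color-pres : ∀ u → Z.color ⟦ u ⟧ ≡ Y.color u

-- Unlike the bijection in `_≅ᵍ_`, this form is symmetric: whatever is proved for one homomorphism
-- applies to its inverse with the roles exchanged.
record GraphIso (Y : ColoredGraph a₁ b₁ e₁) (Z : ColoredGraph a₂ b₂ e₂)
       : Set (a₁ ⊔ b₁ ⊔ e₁ ⊔ a₂ ⊔ b₂ ⊔ e₂) where
  field
    to   : GraphHom Y Z
    from : GraphHom Z Y
  open GraphHom to public
  field
    to∘from : ∀ v → ColoredGraph._≈_ Z ⟦ GraphHom.⟦_⟧ from v ⟧ v
    from∘to : ∀ v → ColoredGraph._≈_ Y (GraphHom.⟦_⟧ from ⟦ v ⟧) v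

module _ {Y : ColoredGraph a₁ b₁ e₁} {Z : ColoredGraph a₂ b₂ e₂} where
  private
    module Y = ColoredGraph Y
    module Z = ColoredGraph Z
    module VY = Setoid Y.V
    module VZ = Setoid Z.V

  GraphIso⇒≅ᵍ : GraphIso Y Z → Y ≅ᵍ Z
  GraphIso⇒≅ᵍ f = record
    { bijection = record
      { to        = ⟦_⟧
      ; cong      = ⟦⟧-cong
      ; bijective =
          (λ {u} {v} q → VY.trans (VY.sym (from∘to u))
            (VY.trans (From.⟦⟧-cong q) (from∘to v)))
        , (λ v → From.⟦ v ⟧ , λ q → VZ.trans (⟦⟧-cong q) (to∘from v))
      }
    ; edges     = λ u v → mk⇔ Adj-pres
        (λ d → Y.Adj-resp (from∘to u) (from∘to v) (From.Adj-pres d))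
    ; colors    = color-pres
    }
    where
    open GraphIso f
    module From = GraphHom from

  ≅ᵍ⇒GraphIso : Y ≅ᵍ Z → GraphIso Y Z
  ≅ᵍ⇒GraphIso f = record
    { to      = record
      { ⟦_⟧        = to
      ; ⟦⟧-cong    = cong′
      ; Adj-pres   = λ {u} {v} → Equivalence.to (edges u v)
      ; color-pres = colors
      }
    ; from    = record
      { ⟦_⟧        = from
      ; ⟦⟧-cong    = λ {u} {v} q → injective
          (VZ.trans (to∘from u) (VZ.trans q (VZ.sym (to∘from v))))
      ; Adj-pres   = λ {u} {v} d → Equivalence.from (edges (from u) (from v))
          (Z.Adj-resp (VZ.sym (to∘from u)) (VZ.sym (to∘from v)) d)
      ; color-pres = λ v → ≡.trans (≡.sym (colors (from v))) (Z.color-cong (to∘from v))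
      }
    ; to∘from = to∘from
    ; from∘to = λ v → injective (to∘from (to v))
    }
    where
    open _≅ᵍ_ f
    open Bijection bijection using (to; injective; surjective) renaming (cong to cong′)
    from : Z.Vertex → Y.Vertex
    from v = proj₁ (surjective v)
    to∘from : ∀ v → to (from v) Z.≈ v
    to∘from v = proj₂ (surjective v) VY.refl

-- Isomorphisms of composition series as inverse pairs of homomorphisms.

record SeriesHom {G : FiniteGroup c₁ ℓ₁} {H : FiniteGroup c₂ ℓ₂}
                 (S : CompositionSeries G p₁) (S′ : CompositionSeries H p₂)
                 : Set (c₁ ⊔ ℓ₁ ⊔ p₁ ⊔ c₂ ⊔ ℓ₂ ⊔ p₂) where
  private
    module G = FiniteGroup G
    module H = FiniteGroup H
    module S = CompositionSeries S
    module S′ = CompositionSeries S′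
  field
    ⟦_⟧       : G.Carrier → H.Carrier
    ⟦⟧-cong   : ∀ {x y} → x G.≈ y → ⟦ x ⟧ H.≈ ⟦ y ⟧
    homo      : ∀ x y → ⟦ x G.∙ y ⟧ H.≈ ⟦ x ⟧ H.∙ ⟦ y ⟧
    length    : S.len ≡ S′.len
    -- Only the inclusion of the image of G_i in H_i is asked for; in `SeriesIso` the inverse
    -- supplies the other inclusion.
    term-pres : ∀ i j → toℕ i ≡ toℕ j → ∀ {g} →
                g ∈ Subgroup.member (S.term i) → ⟦ g ⟧ ∈ Subgroup.member (S′.term j)

  -- The image of the identity is idempotent, and a group has only one idempotent.
  ε-homo : ⟦ G.ε ⟧ H.≈ H.ε
  ε-homo = GroupProperties.identityʳ-unique H.group ⟦ G.ε ⟧ ⟦ G.ε ⟧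
    (H.trans (H.sym (homo G.ε G.ε)) (⟦⟧-cong (G.identityʳ G.ε)))

  ⁻¹-homo : ∀ x → ⟦ x G.⁻¹ ⟧ H.≈ ⟦ x ⟧ H.⁻¹
  ⁻¹-homo x = GroupProperties.inverseʳ-unique H.group ⟦ x ⟧ ⟦ x G.⁻¹ ⟧
    (H.trans (H.sym (homo x (x G.⁻¹))) (H.trans (⟦⟧-cong (G.inverseʳ x)) ε-homo))

record SeriesIso {G : FiniteGroup c₁ ℓ₁} {H : FiniteGroup c₂ ℓ₂}
                 (S : CompositionSeries G p₁) (S′ : CompositionSeries H p₂)
                 : Set (c₁ ⊔ ℓ₁ ⊔ p₁ ⊔ c₂ ⊔ ℓ₂ ⊔ p₂) where
  field
    to   : SeriesHom S S′
    from : SeriesHom S′ S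
  open SeriesHom to public
  field
    to∘from : ∀ h → FiniteGroup._≈_ H ⟦ SeriesHom.⟦_⟧ from h ⟧ h
    from∘to : ∀ g → FiniteGroup._≈_ G (SeriesHom.⟦_⟧ from ⟦ g ⟧) g

SeriesIso-sym : {G : FiniteGroup c₁ ℓ₁} {H : FiniteGroup c₂ ℓ₂}
                {S : CompositionSeries G p₁} {S′ : CompositionSeries H p₂} →
                SeriesIso S S′ → SeriesIso S′ S
SeriesIso-sym f = record { to = from ; from = to ; to∘from = from∘to ; from∘to = to∘from }
  where open SeriesIso f

module _ {G : FiniteGroup c₁ ℓ₁} {H : FiniteGroup c₂ ℓ₂}
         {S : CompositionSeries G p₁} {S′ : CompositionSeries H p₂} where
  private
    module G = FiniteGroup G
    module H = FiniteGroup H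
    module S = CompositionSeries S
    module S′ = CompositionSeries S′

  SeriesIso⇒≅ˢ : SeriesIso S S′ → S ≅ˢ S′
  SeriesIso⇒≅ˢ f = record
    { φ      = ⟦_⟧
    ; φ-iso  = record
      { isGroupMonomorphism = record
        { isGroupHomomorphism = record
          { isMonoidHomomorphism = record
            { isMagmaHomomorphism = record
              { isRelHomomorphism = record { cong = ⟦⟧-cong }
              ; homo              = homo
              }
            ; ε-homo = ε-homo
            }
          ; ⁻¹-homo = ⁻¹-homo
          }
        ; injective = λ {x} {y} q →
            G.trans (G.sym (from∘to x)) (G.trans (From.⟦⟧-cong q) (from∘to y))
        }
      ; surjective = λ h → From.⟦ h ⟧ , λ q → H.trans (⟦⟧-cong q) (to∘from h)
      }
    ; length = length
    ; image  = λ i j i≡j →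
        (λ (g , g∈ , q) → Subgroup.resp (S′.term j) q (term-pres i j i≡j g∈))
      , (λ {h} h∈ → From.⟦ h ⟧ , From.term-pres j i (≡.sym i≡j) h∈ , to∘from h)
    }
    where
    open SeriesIso f
    module From = SeriesHom from

  ≅ˢ⇒SeriesIso : S ≅ˢ S′ → SeriesIso S S′
  ≅ˢ⇒SeriesIso f = record
    { to      = record
      { ⟦_⟧       = φ
      ; ⟦⟧-cong   = ⟦⟧-cong
      ; homo      = ∙-homo
      ; length    = length
      ; term-pres = λ i j i≡j {g} g∈ → proj₁ (image i j i≡j) (g , g∈ , H.refl)
      }
    ; from    = record
      { ⟦_⟧       = ψ
      ; ⟦⟧-cong   = λ {x} {y} q → injective (H.trans (φψ x) (H.trans q (H.sym (φψ y))))
      ; homo      = λ x y → injective (H.trans (φψ (x H.∙ y))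
          (H.sym (H.trans (∙-homo (ψ x) (ψ y)) (H.∙-cong (φψ x) (φψ y)))))
      ; length    = ≡.sym length
      ; term-pres = λ j i j≡i {h} h∈ →
          let (g , g∈ , q) = proj₂ (image i j (≡.sym j≡i)) h∈
          in Subgroup.resp (S.term i) (injective (H.trans q (H.sym (φψ h)))) g∈
      }
    ; to∘from = φψ
    ; from∘to = λ g → injective (φψ (φ g))
    }
    where
    open _≅ˢ_ f
    open GroupMorphisms.IsGroupIsomorphism φ-iso using (⟦⟧-cong; ∙-homo; injective; surjective)
    ψ : H.Carrier → G.Carrier
    ψ h = proj₁ (surjective h)
    φψ : ∀ h → φ (ψ h) H.≈ h
    φψ h = proj₂ (surjective h) G.refl

-- Edges, leaves and levels of the coset tree.

module CosetTreeProperties {G : FiniteGroup c ℓ} (S : CompositionSeries G p) where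
  open FiniteGroup G using (Carrier) renaming (_≈_ to _≈ᴳ_)
  private module G = FiniteGroup G
  open CompositionSeries S using (term; bottom; normal)
  open CosetTree S
  open RootedTree T using (IsLeaf) renaming (_≈_ to _≈ₙ_)

  ≈ₙ⇒∈ : ∀ {i x j y} → (i , x) ≈ₙ (j , y) → y ∈ coset (i , x)
  ≈ₙ⇒∈ {j = j} {y} (_ , g) = g (self∈ j y)

  coset-lift : ∀ i {x z} → z ∈ coset (inject₁ i , x) → z ∈ coset (suc i , x)
  coset-lift i (g , g∈ , q) = g , proj₁ (proj₁ (normal i)) g∈ , q

  -- Membership of the representative is enough: the coset of the larger term through `y` is then
  -- the one through `x`, and it contains the smaller coset through `y`.
  mkEdge : ∀ i {x y} → y ∈ coset (suc i , x) → Edge (suc i , x) (inject₁ i , y)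
  mkEdge i {x} {y} y∈ = edge i x y ((λ z → z) , (λ z → z)) ((λ z → z) , (λ z → z))
    λ z∈ → proj₂ (sameCoset (suc i) y∈) (coset-lift i z∈)

  -- The bottom term is trivial, so the nodes of level `zero` are singletons.
  zero-injective : ∀ {x y} → (zero , x) ≈ₙ (zero , y) → x ≈ᴳ y
  zero-injective {x} {y} q with ≈ₙ⇒∈ q
  ... | g , g∈ , xg≈y =
    G.trans (G.sym (G.identityʳ x)) (G.trans (G.∙-congˡ (G.sym (proj₁ bottom g∈))) xg≈y)

  ≈ᴳ⇒≈ₙ : ∀ i {x y} → x ≈ᴳ y → (i , x) ≈ₙ (i , y)
  ≈ᴳ⇒≈ₙ i {x} q = sameCoset i (G.ε , Subgroup.1-closed (term i) , G.trans (G.identityʳ x) q)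

  child-exists : ∀ {i h} x → toℕ i ≡ suc h → ∃ λ v → Edge (i , x) v
  child-exists {suc i} x _ = (inject₁ i , x) , mkEdge i (self∈ (suc i) x)

  leaf-level : ∀ {i x} → IsLeaf (i , x) → i ≡ zero
  leaf-level {zero}      _  = refl
  leaf-level {suc i} {x} lf = contradiction (mkEdge i (self∈ (suc i) x)) (lf _)

  Edge-level : ∀ {i x j y} → Edge (i , x) (j , y) → toℕ i ≡ suc (toℕ j)
  Edge-level (edge k _ _ r s _) with level-unique r | level-unique s
  ... | refl | refl = cong suc (≡.sym (Fin.toℕ-inject₁ k))

-- The action of a series homomorphism on the coset tree.

module _ {G : FiniteGroup c₁ ℓ₁} {H : FiniteGroup c₂ ℓ₂}
         {S : CompositionSeries G p₁} {S′ : CompositionSeries H p₂} where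
  private
    module H = FiniteGroup H
    module S = CompositionSeries S
    module S′ = CompositionSeries S′
    module C = CosetTree S
    module C′ = CosetTree S′
    module CP = CosetTreeProperties S
    module CP′ = CosetTreeProperties S′

  module _ (f : SeriesHom S S′) where
    open SeriesHom f

    castLevel : Fin (suc S.len) → Fin (suc S′.len)
    castLevel = cast (cong suc length)

    castLevel-inject₁ : ∀ i → castLevel (inject₁ i) ≡ inject₁ (cast length i)
    castLevel-inject₁ i = Fin.toℕ-injective (begin
      toℕ (castLevel (inject₁ i))   ≡⟨ Fin.toℕ-cast _ (inject₁ i) ⟩
      toℕ (inject₁ i)               ≡⟨ Fin.toℕ-inject₁ i ⟩
      toℕ i                         ≡⟨ Fin.toℕ-cast _ i ⟨
      toℕ (cast length i)           ≡⟨ Fin.toℕ-inject₁ _ ⟨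
      toℕ (inject₁ (cast length i)) ∎)
      where open ≡.≡-Reasoning

    castLevel-fromℕ : castLevel (fromℕ S.len) ≡ fromℕ S′.len
    castLevel-fromℕ = Fin.toℕ-injective (begin
      toℕ (castLevel (fromℕ S.len)) ≡⟨ Fin.toℕ-cast _ (fromℕ S.len) ⟩
      toℕ (fromℕ S.len)             ≡⟨ Fin.toℕ-fromℕ S.len ⟩
      S.len                         ≡⟨ length ⟩
      S′.len                        ≡⟨ Fin.toℕ-fromℕ S′.len ⟨
      toℕ (fromℕ S′.len)            ∎)
      where open ≡.≡-Reasoning

    nodeMap : C.Node → C′.Node
    nodeMap (i , x) = castLevel i , ⟦ x ⟧

    nodeMap-∈ : ∀ i {x y} → y ∈ C.coset (i , x) → ⟦ y ⟧ ∈ C′.coset (castLevel i , ⟦ x ⟧)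
    nodeMap-∈ i {x} (g , g∈ , q) =
      ⟦ g ⟧ , term-pres i (castLevel i) (≡.sym (Fin.toℕ-cast _ i)) g∈ ,
      H.trans (H.sym (homo x g)) (⟦⟧-cong q)

    -- Nodes are equal as subsets, so `level-unique` first identifies the levels; after that one
    -- common element makes two cosets of the same term equal.
    nodeMap-cong : ∀ {u v} → RootedTree._≈_ C.T u v →
                   RootedTree._≈_ C′.T (nodeMap u) (nodeMap v)
    nodeMap-cong {i , x} {j , y} q with C.level-unique q
    ... | refl = C′.sameCoset (castLevel i) (nodeMap-∈ i (CP.≈ₙ⇒∈ q))

    nodeMap-Edge : ∀ {u v} → C.Edge u v → C′.Edge (nodeMap u) (nodeMap v)
    nodeMap-Edge {u} {v} (C.edge i x y r s sub) =
      C′.Edge-resp {suc i′ , ⟦ x ⟧} {nodeMap u} {inject₁ i′ , ⟦ y ⟧} {nodeMap v}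
        (nodeMap-cong {suc i , x} {u} (proj₂ r , proj₁ r))
        -- `castLevel (suc i)` computes to `suc i′`, while `castLevel (inject₁ i)` and `inject₁ i′`
        -- agree only propositionally.
        (subst (λ k → RootedTree._≈_ C′.T (k , ⟦ y ⟧) (nodeMap v)) (castLevel-inject₁ i)
          (nodeMap-cong {inject₁ i , y} {v} (proj₂ s , proj₁ s)))
        (CP′.mkEdge i′ (nodeMap-∈ (suc i) (sub (C.self∈ (inject₁ i) y))))
      where
      i′ : Fin S′.len
      i′ = cast length i

    cosetTree-hom : TreeHom C.T C′.T
    cosetTree-hom = record
      { ⟦_⟧       = nodeMap
      ; ⟦⟧-cong   = λ {u} {v} → nodeMap-cong {u} {v}
      ; root-pres = subst (λ k → RootedTree._≈_ C′.T (k , ⟦ FiniteGroup.ε G ⟧) C′.rootNode)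
          (≡.sym castLevel-fromℕ) (CP′.≈ᴳ⇒≈ₙ (fromℕ S′.len) ε-homo)
      ; E-pres    = nodeMap-Edge
      }

module _ {G : FiniteGroup c₁ ℓ₁} {H : FiniteGroup c₂ ℓ₂}
         {S : CompositionSeries G p₁} {S′ : CompositionSeries H p₂} where
  private
    module C = CosetTree S
    module CP = CosetTreeProperties S

  nodeMap-inverse : (f : SeriesHom S S′) (g : SeriesHom S′ S) →
    (∀ x → FiniteGroup._≈_ G (SeriesHom.⟦_⟧ g (SeriesHom.⟦_⟧ f x)) x) →
    ∀ v → RootedTree._≈_ C.T (nodeMap g (nodeMap f v)) v
  nodeMap-inverse f g gf (i , x) =
    subst (λ k → RootedTree._≈_ C.T (k , _) (i , x))
      (≡.sym (Fin.cast-involutive (cong suc g.length) (cong suc f.length) i))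
      (CP.≈ᴳ⇒≈ₙ i (gf x))
    where
    module f = SeriesHom f
    module g = SeriesHom g

-- The action of a series isomorphism on X(S).

module _ {G : FiniteGroup c₁ ℓ₁} {H : FiniteGroup c₂ ℓ₂}
         {S : CompositionSeries G p₁} {S′ : CompositionSeries H p₂} where
  private
    module G = FiniteGroup G
    module H = FiniteGroup H
    module C = CosetTree S
    module C′ = CosetTree S′
    module CP′ = CosetTreeProperties S′
    module X = GraphOfSeries S
    module X′ = GraphOfSeries S′
    module VX′ = Setoid (RootedTree.V X′.tree)

  cosetTree-iso : SeriesIso S S′ → TreeIso C.T C′.T
  cosetTree-iso f = record
    { to      = cosetTree-hom to
    ; from    = cosetTree-hom from
    ; to∘from = nodeMap-inverse from to to∘from
    ; from∘to = nodeMap-inverse to from from∘to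
    }
    where open SeriesIso f

  seriesTree-iso : SeriesIso S S′ → TreeIso X.tree X′.tree
  seriesTree-iso f = ⊙-iso (⊙-iso (cosetTree-iso f) (cosetTree-iso f)) (TreeIso-refl M)

  module _ (f : SeriesIso S S′) where
    private
      module f = SeriesIso f
      τ = cosetTree-iso f
      module F = TreeIso (seriesTree-iso f)
      module TT = PairProperties C′.T C′.T
      module TTM = PairProperties (C′.T ⊙ C′.T) M

    -- This does not hold by computation, because `pair` tests its second entry for being the root:
    -- when `len` is 0 the node `(zero , y)` is the root, and the pair collapses to its first entry.
    triple-pres : ∀ x y m → F.⟦ X.⟨ x , y , m ⟩ ⟧ VX′.≈ X′.⟨ f.⟦ x ⟧ , f.⟦ y ⟧ , m ⟩
    triple-pres x y m = VX′.trans
      (⊙-hom-pair (⊙-iso τ τ) (TreeIso-refl M) _ (proj₁ m))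
      (TTM.pair-cong {y = proj₁ m}
        (Setoid.trans (RootedTree.V (C′.T ⊙ C′.T))
          (⊙-hom-pair τ τ (C.leaf x) (zero , y))
          (TT.pair-cong {y = zero , f.⟦ y ⟧} {zero , f.⟦ y ⟧}
            ((λ z → z) , (λ z → z)) ((λ z → z) , (λ z → z))))
        refl)

    triple-cong : ∀ {x x′ y} m → x H.≈ x′ → X′.⟨ x , y , m ⟩ VX′.≈ X′.⟨ x′ , y , m ⟩
    triple-cong {x} {x′} {y} m q = TTM.pair-cong {y = proj₁ m}
      (TT.pair-cong {y = zero , y} {zero , y} (CP′.≈ᴳ⇒≈ₙ zero q) ((λ z → z) , (λ z → z))) refl

    PathEdge-pres : ∀ {u v} → X.PathEdge u v → X′.PathEdge F.⟦ u ⟧ F.⟦ v ⟧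
    PathEdge-pres (X.←→ x y r s) = X′.←→ f.⟦ x ⟧ f.⟦ y ⟧
      (VX′.trans (F.⟦⟧-cong r) (triple-pres x y ←-leaf))
      (VX′.trans (F.⟦⟧-cong s) (triple-pres y x →-leaf))
    PathEdge-pres (X.→= x y r s) = X′.→= f.⟦ x ⟧ f.⟦ y ⟧
      (VX′.trans (F.⟦⟧-cong r) (triple-pres y x →-leaf))
      (VX′.trans (F.⟦⟧-cong s)
        -- Multiplicativity of `f` makes the image of the "equals" vertex the one required by the
        -- path of `f x` and `f y`.
        (VX′.trans (triple-pres (x G.∙ y) y =-leaf) (triple-cong =-leaf (f.homo x y))))

    seriesGraph-hom : GraphHom (X S) (X S′)
    seriesGraph-hom = record
      { ⟦_⟧        = F.⟦_⟧
      ; ⟦⟧-cong    = F.⟦⟧-cong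
      ; Adj-pres   = λ
        { (fwd (inj₁ d)) → fwd (inj₁ (F.E-pres d))
        ; (fwd (inj₂ d)) → fwd (inj₂ (PathEdge-pres d))
        ; (bwd (inj₁ d)) → bwd (inj₁ (F.E-pres d))
        ; (bwd (inj₂ d)) → bwd (inj₂ (PathEdge-pres d))
        }
      ; color-pres = λ { (inj₁ _) → refl ; (inj₂ _) → refl }
      }

module _ {G : FiniteGroup c₁ ℓ₁} {H : FiniteGroup c₂ ℓ₂}
         {S : CompositionSeries G p₁} {S′ : CompositionSeries H p₂} where
  private module V = Setoid (RootedTree.V (GraphOfSeries.tree S))

  seriesTree-inverse : (f : SeriesIso S S′) (g : SeriesIso S′ S) →
    (∀ x → FiniteGroup._≈_ G (SeriesIso.⟦_⟧ g (SeriesIso.⟦_⟧ f x)) x) → ∀ v →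
    TreeIso.⟦_⟧ (seriesTree-iso g) (TreeIso.⟦_⟧ (seriesTree-iso f) v) V.≈ v
  seriesTree-inverse f g gf = inverse
    where
    node : ∀ x → RootedTree._≈_ (CosetTree.T S) _ x
    node = nodeMap-inverse (SeriesIso.to f) (SeriesIso.to g) gf
    inverse : ∀ v → TreeIso.⟦_⟧ (seriesTree-iso g) (TreeIso.⟦_⟧ (seriesTree-iso f) v) V.≈ v
    inverse (inj₁ (inj₁ x))                               = inj₁ (inj₁ (node x))
    inverse (inj₁ (inj₂ ((x , _) , (y , _))))             = inj₁ (inj₂ (node x , node y))
    inverse (inj₂ ((inj₁ x , _) , _))                     = inj₂ (inj₁ (node x) , refl)
    inverse (inj₂ ((inj₂ ((x , _) , (y , _)) , _) , _))   =
      inj₂ (inj₂ (node x , node y) , refl)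

SeriesIso⇒GraphIso : {G : FiniteGroup c₁ ℓ₁} {H : FiniteGroup c₂ ℓ₂}
                     {S : CompositionSeries G p₁} {S′ : CompositionSeries H p₂} →
                     SeriesIso S S′ → GraphIso (X S) (X S′)
SeriesIso⇒GraphIso {S = S} {S′} f = record
  { to      = seriesGraph-hom {S = S} {S′} f
  ; from    = seriesGraph-hom {S = S′} {S} f⁻¹
  ; to∘from = seriesTree-inverse {S = S′} {S} f⁻¹ f (SeriesIso.to∘from f)
  ; from∘to = seriesTree-inverse {S = S} {S′} f f⁻¹ (SeriesIso.from∘to f)
  }
  where
  f⁻¹ : SeriesIso S′ S
  f⁻¹ = SeriesIso-sym f

-- Ranked graphs and preservation of rank.

record RankedGraph (a e : Level) : Set (lsuc (a ⊔ e)) where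
  field
    Vertex   : Set a
    Adj      : Rel Vertex e
    rank     : Vertex → ℕ
    rank-Adj : ∀ {u v} → Adj u v → rank u ≡ suc (rank v) ⊎ rank v ≡ suc (rank u)
    descend  : ∀ {u h} → rank u ≡ suc h → ∃ λ v → Adj u v × rank v ≡ h

-- Preservation is asked only at rank 0, the one rank that the colors of X(S) reveal directly.
record RankedHom (A : RankedGraph a₁ e₁) (B : RankedGraph a₂ e₂)
       : Set (a₁ ⊔ e₁ ⊔ a₂ ⊔ e₂) where
  private
    module A = RankedGraph A
    module B = RankedGraph B
  field
    ⟦_⟧       : A.Vertex → B.Vertex
    Adj-pres  : ∀ {u v} → A.Adj u v → B.Adj ⟦ u ⟧ ⟦ v ⟧
    zero-pres : ∀ {u} → A.rank u ≡ 0 → B.rank ⟦ u ⟧ ≡ 0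

-- If v has rank h + 1, its image is adjacent to a vertex of rank h, so it has rank h + 1 or
-- h - 1; in the latter case the inverse map would already preserve that smaller rank.
rank-pres : (A : RankedGraph a₁ e₁) (B : RankedGraph a₂ e₂)
            (f : RankedHom A B) (g : RankedHom B A) →
            let open RankedGraph; open RankedHom in
            (∀ u → rank A (⟦ g ⟧ (⟦ f ⟧ u)) ≡ rank A u) →
            (∀ v → rank B (⟦ f ⟧ (⟦ g ⟧ v)) ≡ rank B v) →
            ∀ n {h} → h < n → ∀ u → rank A u ≡ h → rank B (⟦ f ⟧ u) ≡ h
rank-pres A B f g gf fg (suc n) {zero}  _           u eq = RankedHom.zero-pres f eq
rank-pres A B f g gf fg (suc n) {suc h} (s≤s h<n) u eq
  with RankedGraph.descend A eq
... | v , d , eq′ with rank-pres A B f g gf fg n h<n v eq′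
                     | RankedGraph.rank-Adj B (RankedHom.Adj-pres f d)
...   | ih | inj₁ q = ≡.trans q (cong suc ih)
...   | ih | inj₂ q = contradiction (begin
  suc (suc (B.rank (f.⟦ u ⟧)))  ≡⟨ cong suc q ⟨
  suc (B.rank (f.⟦ v ⟧))        ≡⟨ cong suc ih ⟩
  suc h                         ≡⟨ eq ⟨
  A.rank u                      ≡⟨ gf u ⟨
  A.rank (g.⟦ f.⟦ u ⟧ ⟧)        ≡⟨ rank-pres B A g f fg gf n fu<n f.⟦ u ⟧ refl ⟩
  B.rank f.⟦ u ⟧                ∎) (ℕ.<⇒≢ (ℕ.m<n⇒m<1+n (ℕ.n<1+n _)) ∘ ≡.sym)
  where
  open ≡.≡-Reasoning
  module A = RankedGraph A
  module B = RankedGraph B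
  module f = RankedHom f
  module g = RankedHom g
  fu<n : B.rank f.⟦ u ⟧ < n
  fu<n = ℕ.<-trans (ℕ.≤-reflexive (≡.trans (≡.sym q) ih)) h<n

-- Heights, colors and adjacency in X(S).

mcolor-injective : ∀ {m n} → mcolor m ≡ mcolor n → m ≡ n
mcolor-injective {mroot} {mroot} _ = refl
mcolor-injective {←ₘ}    {←ₘ}    _ = refl
mcolor-injective {→ₘ}    {→ₘ}    _ = refl
mcolor-injective {=ₘ}    {=ₘ}    _ = refl

M-edge : ∀ {m} → ¬ m ≡ mroot → MEdge mroot m
M-edge {mroot} m≉ = contradiction refl m≉
M-edge {←ₘ}    _  = to-←
M-edge {→ₘ}    _  = to-→
M-edge {=ₘ}    _  = to-=

module InternalTree {G : FiniteGroup c ℓ} (S : CompositionSeries G p) where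
  open FiniteGroup G using (Carrier) renaming (_≈_ to _≈ᴳ_; _∙_ to _∙ᴳ_)
  open CompositionSeries S using (len)
  open CosetTree S
  open CosetTreeProperties S
  open RootedTree T using () renaming (_≈_ to _≈ₙ_)
  open LeafProduct T T
  open PairProperties T T
  open RootedTree (T ⊙ T) public using (V; Vertex; _≈_; E; IsLeaf; Leaf; root)
  open GraphOfSeries S using (Adjacent; ⟨_,_,_⟩; ←→; →=; vertexColor)

  -- The distance to the leaves of `T ⊙ T`. A leaf of the upper copy is also the root of a lower
  -- copy, which has level `len`; hence the summand `len`.
  height : Vertex → ℕ
  height (inj₁ (i , _))           = toℕ i + len
  height (inj₂ (_ , (i , _) , _)) = toℕ i

  height-cong : ∀ {u v} → u ≈ v → height u ≡ height v
  height-cong (inj₁ q)       = cong (λ i → toℕ i + len) (level-unique q)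
  height-cong (inj₂ (_ , q)) = cong toℕ (level-unique q)

  height-≤ : ∀ v → height v ≤ len + len
  height-≤ (inj₁ (i , _)) = ℕ.+-monoˡ-≤ len (Fin.toℕ≤pred[n] i)
  height-≤ (inj₂ (_ , (i , _) , _)) = ℕ.≤-trans (Fin.toℕ≤pred[n] i) (ℕ.m≤m+n len len)

  height-root : height root ≡ len + len
  height-root = cong (_+ len) (Fin.toℕ-fromℕ len)

  height-leaf : ∀ {i x} → RootedTree.IsLeaf T (i , x) → height (inj₁ (i , x)) ≡ len
  height-leaf lf = cong (λ k → toℕ k + len) (leaf-level lf)

  -- In the root case the pair collapses to a leaf of the upper copy and `i` is the top level, so
  -- both sides are `len`.
  height-pair : ∀ l i y → height (pair l (i , y)) ≡ toℕ i
  height-pair l i y with rootNode? (i , y)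
  ... | yes q = ≡.trans (height-leaf (proj₂ l))
                  (≡.trans (≡.sym (Fin.toℕ-fromℕ len)) (cong toℕ (≡.sym (level-unique q))))
  ... | no _  = refl

  height-E : ∀ {u v} → E u v → height u ≡ suc (height v)
  height-E (inner d) = cong (_+ len) (Edge-level d)
  height-E (hang {u} {x} q d) = ≡.trans
    (height-cong {inj₁ u} {inj₁ (proj₁ x)} (inj₁ q))
    (≡.trans (height-leaf (proj₂ x))
      (≡.trans (≡.sym (Fin.toℕ-fromℕ len)) (Edge-level d)))
  height-E (copy _ d) = Edge-level d

  E-descend : ∀ {u h} → height u ≡ suc h → ∃ λ v → E u v
  E-descend {inj₁ (suc i , x)} _ with child-exists {suc i} x refl
  ... | v , d = inj₁ v , inner d
  -- At a leaf of the upper copy `q` says that `len` is positive, so the root of the copy hanging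
  -- there has a child.
  E-descend {inj₁ (zero , x)} q
    with child-exists (proj₂ rootNode) (≡.trans (Fin.toℕ-fromℕ len) q)
  ... | v , d = inj₂ (leaf x , v , child-nonRoot d) , hang ((λ z → z) , (λ z → z)) d
  E-descend {inj₂ (l , (i , y) , _)} q with child-exists y q
  ... | v , d = inj₂ (l , v , child-nonRoot d) , copy ((λ z → z) , (λ z → z)) d

  leaf⇒height≡0 : ∀ {u} → IsLeaf u → height u ≡ 0
  leaf⇒height≡0 {u} lf with height u in eq
  ... | zero  = refl
  ... | suc _ = contradiction (proj₂ (E-descend {u} eq)) (lf _)

  height≡0⇒leaf : ∀ {u} → height u ≡ 0 → IsLeaf u
  height≡0⇒leaf q w d with ≡.trans (≡.sym q) (height-E d)
  ... | ()

  -- Above its leaves the upper copy has heights greater than `len`, and in a lower copy level `len`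
  -- belongs to the root alone, which is identified with the leaf it hangs from.
  height≡len : ∀ u → height u ≡ len → ∃ λ x → u ≈ inj₁ (zero , x)
  height≡len (inj₁ (zero , x)) _ = x , inj₁ ((λ z → z) , (λ z → z))
  height≡len (inj₁ (suc i , x)) q =
    contradiction (≡.sym q) (ℕ.<⇒≢ (s≤s (ℕ.m≤n+m len (toℕ i))))
  height≡len (inj₂ (_ , (i , y) , y≉)) q =
    contradiction (subst (λ k → (k , y) ≈ₙ rootNode) (≡.sym i≡) (sameCoset (fromℕ len)
      (∈coset (fromℕ len) (CompositionSeries.top S _)))) y≉
    where
    i≡ : i ≡ fromℕ len
    i≡ = Fin.toℕ-injective (≡.trans q (≡.sym (Fin.toℕ-fromℕ len)))

  ranked : RankedGraph _ _
  ranked = record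
    { Vertex   = Vertex
    ; Adj      = SymClosure E
    ; rank     = height
    ; rank-Adj = λ { (fwd d) → inj₁ (height-E d) ; (bwd d) → inj₂ (height-E d) }
    ; descend  = λ {u} q → let (v , d) = E-descend {u} q in
        v , fwd d , ℕ.suc-injective (≡.trans (≡.sym (height-E d)) q)
    }

  ⟪_,_⟫ : Carrier → Carrier → Vertex
  ⟪ x , y ⟫ = pair (leaf x) (zero , y)

  ⟪,⟫-injective : ∀ {x y x′ y′} → ⟪ x , y ⟫ ≈ ⟪ x′ , y′ ⟫ → x ≈ᴳ x′ × y ≈ᴳ y′
  ⟪,⟫-injective {x} {y} {x′} {y′} q
    with pair-injective {leaf x} {leaf x′} {zero , y} {zero , y′} q
  ... | r , s = zero-injective r , zero-injective s

  -- Both ends of a path edge are colored, so only tree edges join uncolored vertices.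
  internal-Adj : ∀ {u v} → Adjacent (inj₁ u) (inj₁ v) → SymClosure E u v
  internal-Adj (fwd (inj₁ (LeafProduct.inner d))) = fwd d
  internal-Adj (bwd (inj₁ (LeafProduct.inner d))) = bwd d
  internal-Adj (fwd (inj₂ (←→ _ _ () _)))
  internal-Adj (fwd (inj₂ (→= _ _ () _)))
  internal-Adj (bwd (inj₂ (←→ _ _ () _)))
  internal-Adj (bwd (inj₂ (→= _ _ () _)))

  -- Since path edges avoid uncolored vertices, an uncolored neighbor of a colored vertex can only
  -- be its parent.
  hang-Adj : ∀ {u l m} → Adjacent (inj₁ u) (inj₂ (l , m)) → u ≈ proj₁ l
  hang-Adj (fwd (inj₁ (LeafProduct.hang q _))) = q
  hang-Adj (fwd (inj₂ (←→ _ _ () _)))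
  hang-Adj (fwd (inj₂ (→= _ _ () _)))
  hang-Adj (bwd (inj₂ (←→ _ _ _ ())))
  hang-Adj (bwd (inj₂ (→= _ _ _ ())))

  -- No edge of `M` joins two of its leaves, which excludes tree edges, and the colors exclude every
  -- path edge except a forward `←→`. Injectivity of pairs then compares the entries.
  ←→-Adj : ∀ {x y z w} → Adjacent ⟨ x , y , ←-leaf ⟩ ⟨ z , w , →-leaf ⟩ → y ≈ᴳ z × x ≈ᴳ w
  ←→-Adj (fwd (inj₁ (LeafProduct.copy _ ())))
  ←→-Adj (bwd (inj₁ (LeafProduct.copy _ ())))
  ←→-Adj {x} {y} {z} {w} (fwd (inj₂ (←→ x′ y′ (inj₂ (q , _)) (inj₂ (r , _)))))
    with ⟪,⟫-injective {x} {y} {x′} {y′} q | ⟪,⟫-injective {z} {w} {y′} {x′} r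
  ... | xx , yy | zy , wx =
    FiniteGroup.trans G yy (FiniteGroup.sym G zy) , FiniteGroup.trans G xx (FiniteGroup.sym G wx)
  ←→-Adj (fwd (inj₂ (→= _ _ (inj₂ (_ , ())) _)))
  ←→-Adj (bwd (inj₂ (←→ _ _ (inj₂ (_ , ())) _)))
  ←→-Adj (bwd (inj₂ (→= _ _ _ (inj₂ (_ , ())))))

  →=-Adj : ∀ {x y z w} → Adjacent ⟨ y , x , →-leaf ⟩ ⟨ z , w , =-leaf ⟩ → z ≈ᴳ x ∙ᴳ y
  →=-Adj (fwd (inj₁ (LeafProduct.copy _ ())))
  →=-Adj (bwd (inj₁ (LeafProduct.copy _ ())))
  →=-Adj {x} {y} {z} {w} (fwd (inj₂ (→= x′ y′ (inj₂ (q , _)) (inj₂ (r , _)))))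
    with ⟪,⟫-injective {y} {x} {y′} {x′} q | ⟪,⟫-injective {z} {w} {x′ ∙ᴳ y′} {y′} r
  ... | yy , xx | zxy , _ =
    FiniteGroup.trans G zxy (FiniteGroup.sym G (FiniteGroup.∙-cong G xx yy))
  →=-Adj (fwd (inj₂ (←→ _ _ (inj₂ (_ , ())) _)))
  →=-Adj (bwd (inj₂ (←→ _ _ (inj₂ (_ , ())) _)))
  →=-Adj (bwd (inj₂ (→= _ _ (inj₂ (_ , ())) _)))

  uncolored : ∀ v → vertexColor v ≡ internal → ∃ λ u → v ≡ inj₁ u
  uncolored (inj₁ u)                 _  = u , refl
  uncolored (inj₂ (_ , mroot , m≉)) _  = contradiction refl m≉

  -- The color of `v` determines its node in `M`, and the edge determines the leaf of `T ⊙ T` from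
  -- which it hangs.
  colored-neighbor : ∀ {u m} v → ¬ m ≡ mroot → vertexColor v ≡ mcolor m → Adjacent (inj₁ u) v →
                     ∃ λ l → ∃ λ m≉ → v ≡ inj₂ (l , m , m≉) × u ≈ proj₁ l
  colored-neighbor (inj₁ _) m≉ q _ = contradiction (mcolor-injective {n = mroot} (≡.sym q)) m≉
  colored-neighbor (inj₂ (l , m′ , m′≉)) m≉ q d with mcolor-injective {m′} q
  ... | refl = l , m′≉ , refl , hang-Adj d


-- Restriction of a graph homomorphism to the uncolored vertices.

module InternalMap {G : FiniteGroup c₁ ℓ₁} {H : FiniteGroup c₂ ℓ₂}
                   (S : CompositionSeries G p₁) (S′ : CompositionSeries H p₂)
                   (f : GraphHom (X S) (X S′)) where
  private
    module I = InternalTree S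
    module I′ = InternalTree S′
    module f = GraphHom f
    module VX′ = Setoid (ColoredGraph.V (X S′))

  private
    F-exists : ∀ u → ∃ λ v → f.⟦ inj₁ u ⟧ ≡ inj₁ v
    F-exists u = I′.uncolored f.⟦ inj₁ u ⟧ (f.color-pres (inj₁ u))

  F : I.Vertex → I′.Vertex
  F u = proj₁ (F-exists u)

  F-eq : ∀ u → f.⟦ inj₁ u ⟧ ≡ inj₁ (F u)
  F-eq u = proj₂ (F-exists u)

  F-cong : ∀ {u v} → u I.≈ v → F u I′.≈ F v
  F-cong {u} {v} q with ≡.subst₂ VX′._≈_ (F-eq u) (F-eq v) (f.⟦⟧-cong (inj₁ q))
  ... | inj₁ r = r

  F-Adj : ∀ {u v} → SymClosure I.E u v → SymClosure I′.E (F u) (F v)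
  F-Adj {u} {v} d = I′.internal-Adj
    (≡.subst₂ (ColoredGraph.Adj (X S′)) (F-eq u) (F-eq v) (f.Adj-pres (lift d)))
    where
    lift : SymClosure I.E u v → ColoredGraph.Adj (X S) (inj₁ u) (inj₁ v)
    lift (fwd e) = fwd (inj₁ (LeafProduct.inner e))
    lift (bwd e) = bwd (inj₁ (LeafProduct.inner e))

  -- The tree edge from `l` to its child `m` is mapped to an edge from an uncolored to a colored
  -- vertex, which is again a tree edge at a leaf.
  F-colored : ∀ (l : I.Leaf) {m} (m≉ : ¬ m ≡ mroot) →
              ∃ λ l′ → ∃ λ m≉′ →
              f.⟦ inj₂ (l , m , m≉) ⟧ ≡ inj₂ (l′ , m , m≉′) × F (proj₁ l) I′.≈ proj₁ l′
  F-colored l {m} m≉ = I′.colored-neighbor f.⟦ inj₂ (l , m , m≉) ⟧ m≉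
    (f.color-pres (inj₂ (l , m , m≉)))
    (subst (λ u → ColoredGraph.Adj (X S′) u f.⟦ inj₂ (l , m , m≉) ⟧) (F-eq (proj₁ l))
      (f.Adj-pres (fwd (inj₁ (LeafProduct.hang (Setoid.refl I.V) (M-edge m≉))))))

  F-zero : ∀ {u} → I.height u ≡ 0 → I′.height (F u) ≡ 0
  -- Any one of the three colored children of `u` witnesses that the image of `u` is a leaf.
  F-zero {u} q with F-colored (u , I.height≡0⇒leaf q) {←ₘ} (λ ())
  ... | (l′ , lf) , _ , _ , r = ≡.trans (I′.height-cong r) (I′.leaf⇒height≡0 lf)

  rankedHom : RankedHom I.ranked I′.ranked
  rankedHom = record { ⟦_⟧ = F ; Adj-pres = F-Adj ; zero-pres = λ {u} → F-zero {u} }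

-- Recovering the group and its series from the graph.

module RecoverSeries {G : FiniteGroup c₁ ℓ₁} {H : FiniteGroup c₂ ℓ₂}
               (S : CompositionSeries G p₁) (S′ : CompositionSeries H p₂)
               (f : GraphHom (X S) (X S′)) (g : GraphHom (X S′) (X S))
               (gf : ∀ v → ColoredGraph._≈_ (X S) (GraphHom.⟦_⟧ g (GraphHom.⟦_⟧ f v)) v)
               (fg : ∀ v → ColoredGraph._≈_ (X S′) (GraphHom.⟦_⟧ f (GraphHom.⟦_⟧ g v)) v) where
  private
    module G = FiniteGroup G
    module H = FiniteGroup H
    module S = CompositionSeries S
    module S′ = CompositionSeries S′
    module C = CosetTree S
    module C′ = CosetTree S′
    module CP = CosetTreeProperties S
    module CP′ = CosetTreeProperties S′
    module I = InternalTree S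
    module I′ = InternalTree S′
    module f = GraphHom f
    module V′ = Setoid I′.V
    module VX′ = Setoid (ColoredGraph.V (X S′))
    module P = PairProperties C.T C.T
    module P′ = PairProperties C′.T C′.T
    open LeafProduct C.T C.T using (pair)
    open LeafProduct C′.T C′.T using () renaming (pair to pair′)
    open InternalMap S S′ f
    module B = InternalMap S′ S g

  B∘F : ∀ u → B.F (F u) I.≈ u
  B∘F u = drop-inj₁ (subst (λ v → ColoredGraph._≈_ (X S) v (inj₁ u))
    (≡.trans (cong (GraphHom.⟦_⟧ g) (F-eq u)) (B.F-eq (F u))) (gf (inj₁ u)))

  F∘B : ∀ u → F (B.F u) I′.≈ u
  F∘B u = drop-inj₁ (subst (λ v → ColoredGraph._≈_ (X S′) v (inj₁ u))
    (≡.trans (cong f.⟦_⟧ (B.F-eq u)) (F-eq (B.F u))) (fg (inj₁ u)))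

  height-pres : ∀ u → I′.height (F u) ≡ I.height u
  height-pres u = rank-pres I.ranked I′.ranked rankedHom B.rankedHom
    (λ v → I.height-cong (B∘F v)) (λ v → I′.height-cong (F∘B v))
    -- The recursion bound of `rank-pres` has to exceed the rank in question; its successor is
    -- enough.
    (suc (I.height u)) (ℕ.n<1+n _) u refl

  -- The root attains the greatest height, twice the length, and its image has the same height.
  len+len-≤ : S.len + S.len ≤ S′.len + S′.len
  len+len-≤ = begin
    S.len + S.len        ≡⟨ I.height-root ⟨
    I.height I.root      ≡⟨ height-pres I.root ⟨
    I′.height (F I.root) ≤⟨ I′.height-≤ (F I.root) ⟩
    S′.len + S′.len      ∎
    where open ℕ.≤-Reasoning

  len-≤ : S.len ≤ S′.len
  len-≤ with S.len ℕ.≤? S′.len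
  ... | yes q = q
  ... | no q  = contradiction len+len-≤ (ℕ.<⇒≱ (ℕ.+-mono-< (ℕ.≰⇒> q) (ℕ.≰⇒> q)))

  -- X(S) is undirected, and heights restore the direction: a reversed edge would put the height of
  -- `v` two above itself.
  F-E : ∀ {u v} → I.E u v → I′.E (F u) (F v)
  F-E {u} {v} d with F-Adj (fwd d)
  ... | fwd e = e
  ... | bwd e = contradiction (begin
    suc (suc (I.height v))  ≡⟨ cong suc (I.height-E d) ⟨
    suc (I.height u)        ≡⟨ cong suc (height-pres u) ⟨
    suc (I′.height (F u))   ≡⟨ I′.height-E e ⟨
    I′.height (F v)         ≡⟨ height-pres v ⟩
    I.height v              ∎) (ℕ.<⇒≢ (ℕ.m<n⇒m<1+n (ℕ.n<1+n _)) ∘ ≡.sym)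
    where open ≡.≡-Reasoning

  -- Equality of lengths enters as a parameter because it combines `len-≤` with the same lemma for
  -- `S` and `S′` exchanged.
  module _ (len-≡ : S.len ≡ S′.len) where
    private
      -- The leaves of the upper copy are recognized by their height `len`, which `F` preserves.
      α-exists : ∀ x → ∃ λ y → F (inj₁ (zero , x)) I′.≈ inj₁ (zero , y)
      α-exists x = I′.height≡len (F (inj₁ (zero , x)))
        (≡.trans (height-pres (inj₁ (zero , x))) len-≡)

    α : G.Carrier → H.Carrier
    α x = proj₁ (α-exists x)

    F-α : ∀ x → F (inj₁ (zero , x)) I′.≈ inj₁ (zero , α x)
    F-α x = proj₂ (α-exists x)

    -- Elements are determined by their leaves. This turns equations between vertices into equations
    -- in `H`, for the congruence of `α` and for the inverse laws.
    α-unique : ∀ {x h} → F (inj₁ (zero , x)) I′.≈ inj₁ (zero , h) → α x H.≈ h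
    α-unique {x} q = CP′.zero-injective (drop-inj₁ (V′.trans (V′.sym (F-α x)) q))

    α-cong : ∀ {x y} → x G.≈ y → α x H.≈ α y
    α-cong {x} {y} q =
      α-unique (V′.trans (F-cong (inj₁ (CP.≈ᴳ⇒≈ₙ zero q))) (F-α y))

    -- Both sides are parents of the same node, since `F` preserves edges, and parents are unique.
    F-parent : ∀ {i x j y} → F (inj₁ (inject₁ i , x)) I′.≈ inj₁ (inject₁ j , y) →
               F (inj₁ (suc i , x)) I′.≈ inj₁ (suc j , y)
    F-parent {i} {x} {j} {y} q = RootedTree.unique-parent (C′.T ⊙ C′.T)
      (RootedTree.E-resp (C′.T ⊙ C′.T) V′.refl q
        (F-E (LeafProduct.inner (CP.mkEdge i (C.self∈ (suc i) x)))))
      (LeafProduct.inner (CP′.mkEdge j (C′.self∈ (suc j) y)))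

    -- Induction from the leaves upward: every coset is reached from the leaf of its representative
    -- by repeatedly passing to the parent.
    F-node : ∀ i j → toℕ i ≡ toℕ j → ∀ x → F (inj₁ (i , x)) I′.≈ inj₁ (j , α x)
    F-node = <-weakInduction _ base step
      where
      P : Fin (suc S.len) → Set _
      P i = ∀ j → toℕ i ≡ toℕ j → ∀ x → F (inj₁ (i , x)) I′.≈ inj₁ (j , α x)
      base : P zero
      base zero _ x = F-α x
      step : ∀ i → P (inject₁ i) → P (suc i)
      step i ih (suc j) q x = F-parent (ih (inject₁ j) (begin
        toℕ (inject₁ i) ≡⟨ Fin.toℕ-inject₁ i ⟩
        toℕ i           ≡⟨ ℕ.suc-injective q ⟩
        toℕ j           ≡⟨ Fin.toℕ-inject₁ j ⟨
        toℕ (inject₁ j) ∎) x)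
        where
        open ≡.≡-Reasoning

    -- Descending along the path, each step goes to a child, and by `pair-E⁻` children never leave
    -- the copy hanging at `α x`.
    F-copy : ∀ x {u v} → Star C.Edge u v →
             ∀ u′ → F (pair (C.leaf x) u) I′.≈ pair′ (C′.leaf (α x)) u′ →
             ∃ λ v′ → F (pair (C.leaf x) v) I′.≈ pair′ (C′.leaf (α x)) v′
    F-copy x ε        u′ q = u′ , q
    F-copy x (d ◅ ds) u′ q =
      let (v′ , _ , r) = P′.pair-E⁻ (C′.leaf (α x))
            (RootedTree.E-resp (C′.T ⊙ C′.T) q V′.refl (F-E (P.pair-E (C.leaf x) d)))
      in F-copy x ds v′ r

    pair-zero : ∀ x y v′ → F I.⟪ x , y ⟫ I′.≈ pair′ (C′.leaf (α x)) v′ →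
                ∃ λ z → F I.⟪ x , y ⟫ I′.≈ I′.⟪ α x , z ⟫
    pair-zero x y (i , z) q =
      z , subst (λ k → F I.⟪ x , y ⟫ I′.≈ pair′ (C′.leaf (α x)) (k , z)) (Fin.toℕ-injective (begin
        toℕ i                                      ≡⟨ I′.height-pair (C′.leaf (α x)) i z ⟨
        I′.height (pair′ (C′.leaf (α x)) (i , z))  ≡⟨ I′.height-cong q ⟨
        I′.height (F I.⟪ x , y ⟫)                  ≡⟨ height-pres I.⟪ x , y ⟫ ⟩
        I.height I.⟪ x , y ⟫                       ≡⟨ I.height-pair (C.leaf x) zero y ⟩
        0                                          ∎)) q
      where open ≡.≡-Reasoning

    F-pair : ∀ x y → ∃ λ z → F I.⟪ x , y ⟫ I′.≈ I′.⟪ α x , z ⟫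
    F-pair x y =
      let (u , path , u≈) = C.Node-reachable (zero , y)
          -- The path starts at the root of the copy, which is the leaf `x` of the upper copy, whose
          -- image is known from `F-α`.
          (v′ , q) = F-copy x path C′.rootNode (V′.trans
            (F-cong (P.pair-root (C.leaf x) {C.rootNode} ((λ z → z) , (λ z → z))))
            (V′.trans (F-α x)
              (V′.sym (P′.pair-root (C′.leaf (α x)) {C′.rootNode} ((λ z → z) , (λ z → z))))))
      in pair-zero x y v′ (V′.trans
           (F-cong (P.pair-cong {C.leaf x} {C.leaf x} {zero , y} {u}
             ((λ z → z) , (λ z → z)) (proj₂ u≈ , proj₁ u≈))) q)

    β : G.Carrier → G.Carrier → H.Carrier
    β x y = proj₁ (F-pair x y)

    F-triple : ∀ x y {m} (m≉ m≉′ : ¬ m ≡ mroot) →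
               f.⟦ inj₂ (leafPair {T₁ = C.T} {T₂ = C.T} (C.leaf x) (C.leaf y) , m , m≉) ⟧
                 VX′.≈
               inj₂ (leafPair {T₁ = C′.T} {T₂ = C′.T} (C′.leaf (α x)) (C′.leaf (β x y)) , m , m≉′)
    F-triple x y m≉ m≉′ =
      let (_ , _ , q , r) = F-colored (leafPair {T₁ = C.T} {T₂ = C.T} (C.leaf x) (C.leaf y)) m≉
      in VX′.trans (VX′.reflexive q) (inj₂ (V′.trans (V′.sym r) (proj₂ (F-pair x y)) , refl))

    -- The edge {(x,y,←), (y,x,→)} is mapped to the edge {(αx,βxy,←), (αy,βyx,→)}.
    β≈α : ∀ x y → β x y H.≈ α y
    β≈α x y = proj₁ (I′.←→-Adj {α x} {β x y} {α y} {β y x}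
      (ColoredGraph.Adj-resp (X S′) (F-triple x y _ _) (F-triple y x _ _)
        (f.Adj-pres (fwd (inj₂ (GraphOfSeries.←→ x y
          (Setoid.refl (ColoredGraph.V (X S))) (Setoid.refl (ColoredGraph.V (X S)))))))))

    -- The edge {(y,x,→), (xy,y,=)} is mapped to {(αy,βyx,→), (α(xy),β(xy)y,=)}, which gives α(xy) =
    -- (βyx)(αy); then `β≈α` replaces the first factor by αx.
    α-homo : ∀ x y → α (x G.∙ y) H.≈ α x H.∙ α y
    α-homo x y = H.trans
      (I′.→=-Adj {β y x} {α y} {α (x G.∙ y)} {β (x G.∙ y) y}
        (ColoredGraph.Adj-resp (X S′) (F-triple y x _ _) (F-triple (x G.∙ y) y _ _)
          (f.Adj-pres (fwd (inj₂ (GraphOfSeries.→= x y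
            (Setoid.refl (ColoredGraph.V (X S))) (Setoid.refl (ColoredGraph.V (X S)))))))))
      (H.∙-congʳ (β≈α y x))

    -- If `x` lies in G_i, then `x` and the identity have the same coset of G_i, so by `F-node`
    -- their images have the same coset of H_j.
    α-term : ∀ i j → toℕ i ≡ toℕ j → ∀ {x} →
             x ∈ Subgroup.member (S.term i) → α x ∈ Subgroup.member (S′.term j)
    α-term i j i≡j {x} x∈ =
      let (k , k∈ , q) = CP′.≈ₙ⇒∈ {j} {α G.ε} {j} {α x} (drop-inj₁ (V′.trans
            (V′.sym (F-node i j i≡j G.ε))
            (V′.trans (F-cong (inj₁ (C.sameCoset i (x , x∈ , G.identityˡ x))))
              (F-node i j i≡j x))))
      in Subgroup.resp (S′.term j)
           -- Multiplying `k` or `α x` on the left by `α G.ε` gives `α x` in both cases, so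
           -- cancellation identifies `k` with `α x`.
           (GroupProperties.∙-cancelˡ H.group (α G.ε) k (α x)
             (H.trans q (H.trans (α-cong (G.sym (G.identityˡ x))) (α-homo G.ε x)))) k∈

    seriesHom : SeriesHom S S′
    seriesHom = record
      { ⟦_⟧ = α ; ⟦⟧-cong = α-cong ; homo = α-homo ; length = len-≡ ; term-pres = α-term }

-- From isomorphic graphs to isomorphic series, and the equivalence.

module _ {G : FiniteGroup c₁ ℓ₁} {H : FiniteGroup c₂ ℓ₂}
         (S : CompositionSeries G p₁) (S′ : CompositionSeries H p₂)
         (f : GraphIso (X S) (X S′)) where
  private
    open GraphIso f
    module R = RecoverSeries S S′ to from from∘to to∘from
    module R⁻¹ = RecoverSeries S′ S from to to∘from from∘to

    len-≡ : CompositionSeries.len S ≡ CompositionSeries.len S′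
    len-≡ = ℕ.≤-antisym R.len-≤ R⁻¹.len-≤

  GraphIso⇒SeriesIso : SeriesIso S S′
  GraphIso⇒SeriesIso = record
    { to      = R.seriesHom len-≡
    ; from    = R⁻¹.seriesHom (≡.sym len-≡)
    -- The two maps on vertices cancel at the leaf of `h`, and `α-unique` reads this as an equation
    -- between elements.
    ; to∘from = λ h → R.α-unique len-≡ (Setoid.trans (InternalTree.V S′)
        (InternalMap.F-cong S S′ to (Setoid.sym (InternalTree.V S) (R⁻¹.F-α (≡.sym len-≡) h)))
        (R.F∘B (inj₁ (zero , h))))
    ; from∘to = λ g → R⁻¹.α-unique (≡.sym len-≡) (Setoid.trans (InternalTree.V S)
        (InternalMap.F-cong S′ S from (Setoid.sym (InternalTree.V S′) (R.F-α len-≡ g)))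
        (R.B∘F (inj₁ (zero , g))))
    }

corollary4p10 : ∀ {c ℓ p c′ ℓ′ p′} {G : FiniteGroup c ℓ} {H : FiniteGroup c′ ℓ′}
    (S : CompositionSeries G p) (S′ : CompositionSeries H p′) →
    (S ≅ˢ S′) ⇔ (X S ≅ᵍ X S′)
corollary4p10 S S′ = mk⇔
  (λ f → GraphIso⇒≅ᵍ {Y = X S} {X S′} (SeriesIso⇒GraphIso {S = S} {S′} (≅ˢ⇒SeriesIso f)))
  (λ f → SeriesIso⇒≅ˢ (GraphIso⇒SeriesIso S S′ (≅ᵍ⇒GraphIso {Y = X S} {X S′} f)))
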